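{- Let $n\ge1$. The map $$\Psi_{2,n}\colon\operatorname{Ch}\bigl(\mathcal H_n^{(2)}\bigr)\longrightarrow\{\mathtt a,\mathtt b\}^n/{\sim_{3/2}},\qquad C\longmapsto[\,\mathtt b^{\,n-r(C)-t(C)}\,\mathtt a^{\,r(C)}\,\mathtt b^{\,t(C)}\,]_{\sim_{3/2}},$$ is a bijection.
   Context: $\mathcal H_n^{(2)}$ is the arrangement in $\mathbb R^2$ of the lines $H_i^{(2)}=\{(x_1,x_2):1+ix_1+i^2x_2=0\}$, $i\in\{1,\dots,n\}$. A chamber is a connected component of the complement of the union of the lines; $\operatorname{Ch}(\mathcal H_n^{(2)})$ is the set of chambers. The sign word of a chamber $C$ is $\sigma(C)=\sigma_1\cdots\sigma_n\in\{+,-\}^n$ with $\sigma_i=\operatorname{sgn}(1+ix_1+i^2x_2)$ for any $(x_1,x_2)\in C$. If $\sigma(C)$ is all plus, set $r(C)=t(C)=0$. Otherwise $\sigma(C)$ is uniquely of the form ${+}^{\,t(C)}\,{ - }^{\,r(C)}\,{+}^{\,n-r(C)-t(C)}$ with $r(C)\ge1$, $t(C)\ge 0$; this defines $r(C),t(C)$. For words, $|w|_{\mathtt a}$ is the number of letters $\mathtt a$ in $w$ and $\binom{w}{\mathtt{ab}}$ is the number of occurrences of $\mathtt{ab}$ as a scattered subword of $w$. Set $\operatorname{strip}(w)=\lfloor\binom{w}{\mathtt{ab}}/|w|_{\mathtt a}\rfloor$ if $|w|_{\mathtt a}>0$ and $\operatorname{strip}(w)=0$ if $|w|_{\mathtt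 a}=0$. For $u,w\in\{\mathtt a,\mathtt b\}^n$, $u\sim_{3/2}w$ means $|u|_{\mathtt a}=|w|_{\mathtt a}$ and $\operatorname{strip}(u)=\operatorname{strip}(w)$; $[w]_{\sim_{3/2}}$ is the class of $w$ in $\{\mathtt a,\mathtt b\}^n$. -}

module Defs where

open import Data.Empty using (⊥)
open import Data.Fin as Fin using (Fin; zero; suc; toℕ)
import Data.Integer as ℤ
import Data.Integer.Properties as ℤ
open import Data.List as List using (List)
import Data.List.Properties as List
open import Data.Nat as ℕ using (ℕ; zero; suc; s≤s; z≤n; _∸_)
import Data.Nat.DivMod as ℕ
import Data.Nat.Properties as ℕ
open import Data.Product using (_×_; _,_; proj₁; proj₂; ∃-syntax)
open import Data.Rational as ℚ using (ℚ; 0ℚ; 1ℚ; ½; ∣_∣; positive; negative)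
import Data.Rational.Properties as ℚ
import Data.Rational.Unnormalised as ℚᵘ
import Data.Rational.Unnormalised.Properties as ℚᵘ
open import Data.Rational.Solver using (module +-*-Solver)
open import Data.Sign using (Sign)
open import Data.Sum using (_⊎_; inj₁; inj₂)
open import Data.Vec as Vec using (Vec; []; _∷_; _++_; replicate; cast; count; toList)
open import Data.Vec.Properties using (lookup∘tabulate)
open import Function using (_∘_)
open import Level using (0ℓ) renaming (suc to lsuc)
open import Relation.Binary.Bundles using (Setoid)
open import Relation.Binary.Definitions using (DecidableEquality)
open import Relation.Binary.PropositionalEquality
open import Relation.Nullary using (¬_; yes; no; contradiction)
open import Relation.Unary using (Pred; _∈_; _⊆_; _∪_; _∩_; Empty; Satisfiable)

-- Cauchy sequences of rationals.  Real equality is never needed: < and hence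
-- every open set is invariant under replacing a sequence by an equivalent one.
record ℝ : Set where
  field
    seq    : ℕ → ℚ
    cauchy : ∀ ε → 0ℚ ℚ.< ε →
             ∃[ N ] (∀ m n → N ℕ.≤ m → N ℕ.≤ n → ∣ seq m ℚ.- seq n ∣ ℚ.< ε)

open ℝ public

private
  half-pos : ∀ ε → 0ℚ ℚ.< ε → 0ℚ ℚ.< ½ ℚ.* ε
  half-pos ε ε>0 =
    ℚ.positive⁻¹ (½ ℚ.* ε) {{ℚ.pos*pos⇒pos ½ ε {{positive ε>0}}}}

  halves : ∀ ε → ½ ℚ.* ε ℚ.+ ½ ℚ.* ε ≡ ε
  halves ε = trans (sym (ℚ.*-distribʳ-+ ε ½ ½)) (ℚ.*-identityˡ ε)

fromℚ : ℚ → ℝ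
fromℚ q = record
  { seq    = λ _ → q
  ; cauchy = λ ε ε>0 → 0 , λ _ _ _ _ →
      subst (ℚ._< ε) (sym (cong ∣_∣ (ℚ.+-inverseʳ q))) ε>0
  }

ℕ⇒ℚ : ℕ → ℚ
ℕ⇒ℚ k = (ℤ.+ k) ℚ./ 1

fromℕ : ℕ → ℝ
fromℕ k = fromℚ (ℕ⇒ℚ k)

infixl 6 _+_
infixl 7 _*_
infix  4 _<_ _#_

_+_ : ℝ → ℝ → ℝ
x + y = record { seq = λ n → seq x n ℚ.+ seq y n ; cauchy = +-cauchy }
  where
  open ℚ.≤-Reasoning
  open +-*-Solver
  rearrange : ∀ a b c d → (a ℚ.+ b) ℚ.- (c ℚ.+ d) ≡ (a ℚ.- c) ℚ.+ (b ℚ.- d)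
  rearrange = solve 4 (λ a b c d → (a :+ b) :- (c :+ d) := (a :- c) :+ (b :- d)) refl
  +-cauchy : ∀ ε → 0ℚ ℚ.< ε → ∃[ N ] (∀ m n → N ℕ.≤ m → N ℕ.≤ n →
    ∣ (seq x m ℚ.+ seq y m) ℚ.- (seq x n ℚ.+ seq y n) ∣ ℚ.< ε)
  +-cauchy ε ε>0 = M ℕ.⊔ N , λ m n hm hn → begin-strict
    ∣ (seq x m ℚ.+ seq y m) ℚ.- (seq x n ℚ.+ seq y n) ∣
      ≡⟨ cong ∣_∣ (rearrange (seq x m) (seq y m) (seq x n) (seq y n)) ⟩
    ∣ (seq x m ℚ.- seq x n) ℚ.+ (seq y m ℚ.- seq y n) ∣
      ≤⟨ ℚ.∣p+q∣≤∣p∣+∣q∣ (seq x m ℚ.- seq x n) (seq y m ℚ.- seq y n) ⟩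
    ∣ seq x m ℚ.- seq x n ∣ ℚ.+ ∣ seq y m ℚ.- seq y n ∣
      <⟨ ℚ.+-mono-< (hM m n (ℕ.m⊔n≤o⇒m≤o M N hm) (ℕ.m⊔n≤o⇒m≤o M N hn))
                    (hN m n (ℕ.m⊔n≤o⇒n≤o M N hm) (ℕ.m⊔n≤o⇒n≤o M N hn)) ⟩
    ½ ℚ.* ε ℚ.+ ½ ℚ.* ε
      ≡⟨ halves ε ⟩
    ε ∎
    where
    M  = proj₁ (cauchy x _ (half-pos ε ε>0))
    hM = proj₂ (cauchy x _ (half-pos ε ε>0))
    N  = proj₁ (cauchy y _ (half-pos ε ε>0))
    hN = proj₂ (cauchy y _ (half-pos ε ε>0))

private
  bounded : (x : ℝ) → ∃[ B ] ∃[ N ]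
            (ℚ.Positive B × (∀ n → N ℕ.≤ n → ∣ seq x n ∣ ℚ.≤ B))
  bounded x =
    1ℚ ℚ.+ ∣ seq x N ∣ , N
    , ℚ.pos+nonNeg⇒pos 1ℚ ∣ seq x N ∣ {{ℚ.∣-∣-nonNeg (seq x N)}} , λ n N≤n → begin
      ∣ seq x n ∣
        ≡⟨ cong ∣_∣ (split (seq x n) (seq x N)) ⟩
      ∣ (seq x n ℚ.- seq x N) ℚ.+ seq x N ∣
        ≤⟨ ℚ.∣p+q∣≤∣p∣+∣q∣ (seq x n ℚ.- seq x N) (seq x N) ⟩
      ∣ seq x n ℚ.- seq x N ∣ ℚ.+ ∣ seq x N ∣
        ≤⟨ ℚ.+-monoˡ-≤ ∣ seq x N ∣ (ℚ.<⇒≤ (hN n N N≤n ℕ.≤-refl)) ⟩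
      1ℚ ℚ.+ ∣ seq x N ∣ ∎
    where
    open ℚ.≤-Reasoning
    open +-*-Solver
    N  = proj₁ (cauchy x 1ℚ (ℚ.positive⁻¹ 1ℚ))
    hN = proj₂ (cauchy x 1ℚ (ℚ.positive⁻¹ 1ℚ))
    split : ∀ a b → a ≡ (a ℚ.- b) ℚ.+ b
    split = solve 2 (λ a b → a := (a :- b) :+ b) refl

  shrink : ∀ B ε → ℚ.Positive B → 0ℚ ℚ.< ε →
           ∃[ δ ] (0ℚ ℚ.< δ × B ℚ.* δ ≡ ½ ℚ.* ε)
  shrink B ε B>0 ε>0 =
    1/B ℚ.* (½ ℚ.* ε)
    , ℚ.positive⁻¹ _ {{ℚ.pos*pos⇒pos 1/B {{ℚ.1/pos⇒pos B {{B>0}}}}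
                         (½ ℚ.* ε) {{positive (half-pos ε ε>0)}}}}
    , (begin
      B ℚ.* (1/B ℚ.* (½ ℚ.* ε)) ≡⟨ ℚ.*-assoc B 1/B (½ ℚ.* ε) ⟨
      (B ℚ.* 1/B) ℚ.* (½ ℚ.* ε) ≡⟨ cong (ℚ._* (½ ℚ.* ε)) (ℚ.*-inverseʳ B {{B≠0}}) ⟩
      1ℚ ℚ.* (½ ℚ.* ε)          ≡⟨ ℚ.*-identityˡ (½ ℚ.* ε) ⟩
      ½ ℚ.* ε ∎)
    where
    open ≡-Reasoning
    B≠0 = ℚ.pos⇒nonZero B {{B>0}}
    1/B = ℚ.1/_ B {{B≠0}}

_*_ : ℝ → ℝ → ℝ
x * y = record { seq = λ n → seq x n ℚ.* seq y n ; cauchy = *-cauchy }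
  where
  open ℚ.≤-Reasoning
  open +-*-Solver
  rearrange : ∀ a b c d → (a ℚ.* b) ℚ.- (c ℚ.* d) ≡ a ℚ.* (b ℚ.- d) ℚ.+ d ℚ.* (a ℚ.- c)
  rearrange = solve 4 (λ a b c d →
    (a :* b) :- (c :* d) := a :* (b :- d) :+ d :* (a :- c)) refl

  product-bound : ∀ B δ p q → ℚ.Positive B → ∣ p ∣ ℚ.≤ B → ∣ q ∣ ℚ.< δ → ∣ p ℚ.* q ∣ ℚ.< B ℚ.* δ
  product-bound B δ p q B>0 p≤B q<δ = begin-strict
    ∣ p ℚ.* q ∣     ≡⟨ ℚ.∣p*q∣≡∣p∣*∣q∣ p q ⟩
    ∣ p ∣ ℚ.* ∣ q ∣ ≤⟨ ℚ.*-monoʳ-≤-nonNeg ∣ q ∣ {{ℚ.∣-∣-nonNeg q}} p≤B ⟩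
    B ℚ.* ∣ q ∣     <⟨ ℚ.*-monoʳ-<-pos B {{B>0}} q<δ ⟩
    B ℚ.* δ ∎

  *-cauchy : ∀ ε → 0ℚ ℚ.< ε → ∃[ N ] (∀ m n → N ℕ.≤ m → N ℕ.≤ n →
    ∣ (seq x m ℚ.* seq y m) ℚ.- (seq x n ℚ.* seq y n) ∣ ℚ.< ε)
  *-cauchy ε ε>0 = Nx ℕ.⊔ Ny ℕ.⊔ (M ℕ.⊔ N) , λ m n hm hn →
    let hm₁ = ℕ.m⊔n≤o⇒m≤o (Nx ℕ.⊔ Ny) (M ℕ.⊔ N) hm
        hm₂ = ℕ.m⊔n≤o⇒n≤o (Nx ℕ.⊔ Ny) (M ℕ.⊔ N) hm
        hn₁ = ℕ.m⊔n≤o⇒m≤o (Nx ℕ.⊔ Ny) (M ℕ.⊔ N) hn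
        hn₂ = ℕ.m⊔n≤o⇒n≤o (Nx ℕ.⊔ Ny) (M ℕ.⊔ N) hn
    in begin-strict
    ∣ (seq x m ℚ.* seq y m) ℚ.- (seq x n ℚ.* seq y n) ∣
      ≡⟨ cong ∣_∣ (rearrange (seq x m) (seq y m) (seq x n) (seq y n)) ⟩
    ∣ seq x m ℚ.* (seq y m ℚ.- seq y n) ℚ.+ seq y n ℚ.* (seq x m ℚ.- seq x n) ∣
      ≤⟨ ℚ.∣p+q∣≤∣p∣+∣q∣ (seq x m ℚ.* (seq y m ℚ.- seq y n)) _ ⟩
    ∣ seq x m ℚ.* (seq y m ℚ.- seq y n) ∣ ℚ.+ ∣ seq y n ℚ.* (seq x m ℚ.- seq x n) ∣
      <⟨ ℚ.+-mono-<
           (product-bound A α (seq x m) _ A>0 (hA m (ℕ.m⊔n≤o⇒m≤o Nx Ny hm₁))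
             (hM m n (ℕ.m⊔n≤o⇒m≤o M N hm₂) (ℕ.m⊔n≤o⇒m≤o M N hn₂)))
           (product-bound B β (seq y n) _ B>0 (hB n (ℕ.m⊔n≤o⇒n≤o Nx Ny hn₁))
             (hN m n (ℕ.m⊔n≤o⇒n≤o M N hm₂) (ℕ.m⊔n≤o⇒n≤o M N hn₂))) ⟩
    A ℚ.* α ℚ.+ B ℚ.* β     ≡⟨ cong₂ ℚ._+_ Aα Bβ ⟩
    ½ ℚ.* ε ℚ.+ ½ ℚ.* ε     ≡⟨ halves ε ⟩
    ε ∎
    where
    A   = proj₁ (bounded x)
    Nx  = proj₁ (proj₂ (bounded x))
    A>0 = proj₁ (proj₂ (proj₂ (bounded x)))
    hA  = proj₂ (proj₂ (proj₂ (bounded x)))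
    B   = proj₁ (bounded y)
    Ny  = proj₁ (proj₂ (bounded y))
    B>0 = proj₁ (proj₂ (proj₂ (bounded y)))
    hB  = proj₂ (proj₂ (proj₂ (bounded y)))
    α   = proj₁ (shrink A ε A>0 ε>0)
    α>0 = proj₁ (proj₂ (shrink A ε A>0 ε>0))
    Aα  = proj₂ (proj₂ (shrink A ε A>0 ε>0))
    β   = proj₁ (shrink B ε B>0 ε>0)
    β>0 = proj₁ (proj₂ (shrink B ε B>0 ε>0))
    Bβ  = proj₂ (proj₂ (shrink B ε B>0 ε>0))
    M   = proj₁ (cauchy y α α>0)
    hM  = proj₂ (cauchy y α α>0)
    N   = proj₁ (cauchy x β β>0)
    hN  = proj₂ (cauchy x β β>0)

record _<_ (x y : ℝ) : Set where
  constructor gap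
  field
    δ     : ℚ
    δ>0   : 0ℚ ℚ.< δ
    N     : ℕ
    apart : ∀ n → N ℕ.≤ n → seq x n ℚ.+ δ ℚ.≤ seq y n

-- The positive form of x ≠ y: it says which of the two is larger, so that the
-- sign of a real apart from 0 is a function (classically # and ≠ coincide).
_#_ : ℝ → ℝ → Set
x # y = x < y ⊎ y < x

sgn : ∀ {x} → x # fromℕ 0 → Sign
sgn (inj₁ x<0) = Sign.-
sgn (inj₂ x>0) = Sign.+

ℝ² : Set
ℝ² = ℝ × ℝ

-- The open box  (x₁ - ε , x₁ + ε) × (x₂ - ε , x₂ + ε).  The boxes of rational
-- radius form a base of the Euclidean topology.
Box : ℝ² → ℚ → Pred ℝ² 0ℓ
Box (x₁ , x₂) ε (y₁ , y₂) = near x₁ y₁ × near x₂ y₂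
  where
  near : ℝ → ℝ → Set
  near x y = x < y + fromℚ ε × y < x + fromℚ ε

Open : Pred ℝ² 0ℓ → Set
Open U = ∀ {x} → x ∈ U → ∃[ ε ] (0ℚ ℚ.< ε × Box x ε ⊆ U)

Separated : (S U V : Pred ℝ² 0ℓ) → Set
Separated S U V =
  Open U × Open V × S ⊆ U ∪ V ×
  Satisfiable (S ∩ U) × Satisfiable (S ∩ V) × Empty (S ∩ (U ∩ V))

Connected : Pred ℝ² 0ℓ → Set₁
Connected S = ∀ U V → ¬ Separated S U V

ℓ : ℕ → ℝ² → ℝ
ℓ i (x₁ , x₂) = fromℕ 1 + fromℕ i * x₁ + fromℕ (i ℕ.^ 2) * x₂

-- The index j : Fin n stands for the line H_i with i = j + 1.
Complement : ℕ → Pred ℝ² 0ℓ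
Complement n x = (j : Fin n) → ℓ (suc (toℕ j)) x # fromℕ 0

record Point (n : ℕ) : Set where
  constructor point
  field
    coords : ℝ²
    off    : coords ∈ Complement n

open Point public

-- The relation whose classes are the connected components of the complement.
SameComponent : ∀ {n} → Point n → Point n → Set₁
SameComponent {n} x y =
  ∃[ S ] (Connected S × S ⊆ Complement n × coords x ∈ S × coords y ∈ S)

private
  singleton-connected : ∀ x → Connected (x ≡_)
  singleton-connected x U V
    (_ , _ , _ , (_ , refl , x∈U) , (_ , refl , x∈V) , disjoint) =
    disjoint x (refl , x∈U , x∈V)

  ∪-connected : ∀ {S T z} → Connected S → Connected T → z ∈ S → z ∈ T → Connected (S ∪ T)
  ∪-connected {S} {T} {z} connS connT z∈S z∈T U V
    (openU , openV , cover , (u , u∈ST , u∈U) , (v , v∈ST , v∈V) , disjoint)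
    with cover (inj₁ z∈S)
  ... | inj₁ z∈U = go v∈ST
    where
    go : v ∈ S ∪ T → _
    go (inj₁ v∈S) = connS U V (openU , openV , cover ∘ inj₁ , (z , z∈S , z∈U) , (v , v∈S , v∈V)
      , λ p (p∈S , p∈UV) → disjoint p (inj₁ p∈S , p∈UV))
    go (inj₂ v∈T) = connT U V (openU , openV , cover ∘ inj₂ , (z , z∈T , z∈U) , (v , v∈T , v∈V)
      , λ p (p∈T , p∈UV) → disjoint p (inj₂ p∈T , p∈UV))
  ... | inj₂ z∈V = go u∈ST
    where
    go : u ∈ S ∪ T → _
    go (inj₁ u∈S) = connS U V (openU , openV , cover ∘ inj₁ , (u , u∈S , u∈U) , (z , z∈S , z∈V)
      , λ p (p∈S , p∈UV) → disjoint p (inj₁ p∈S , p∈UV))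
    go (inj₂ u∈T) = connT U V (openU , openV , cover ∘ inj₂ , (u , u∈T , u∈U) , (z , z∈T , z∈V)
      , λ p (p∈T , p∈UV) → disjoint p (inj₂ p∈T , p∈UV))

-- A chamber is given by any of its points; Setoid equality is equality of chambers.
Ch : ℕ → Setoid 0ℓ (lsuc 0ℓ)
Ch n = record
  { Carrier       = Point n
  ; _≈_           = SameComponent
  ; isEquivalence = record
    { refl  = λ {x} → (coords x ≡_) , singleton-connected (coords x)
                    , (λ { refl → off x }) , refl , refl
    ; sym   = λ (S , conn , S⊆ , x∈S , y∈S) → S , conn , S⊆ , y∈S , x∈S
    ; trans = λ (S , connS , S⊆ , x∈S , y∈S) (T , connT , T⊆ , y∈T , z∈T) →
        S ∪ T , ∪-connected connS connT y∈S y∈T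
        , (λ { (inj₁ p) → S⊆ p ; (inj₂ p) → T⊆ p }) , inj₁ x∈S , inj₂ z∈T
    }
  }

σ : ∀ {n} → Point n → Vec Sign n
σ x = Vec.tabulate (λ j → sgn (off x j))

-- w = +ᵗ -ʳ +ⁿ⁻ʳ⁻ᵗ with r ≥ 1, or w is all plus and r = t = 0.
record Shape {n} (w : Vec Sign n) : Set where
  field
    t r      : ℕ
    r+t≤n    : r ℕ.+ t ℕ.≤ n
    word     : toList w ≡ List.replicate t Sign.+ List.++ List.replicate r Sign.-
                          List.++ List.replicate (n ∸ r ∸ t) Sign.+
    all-plus : r ≡ 0 → t ≡ 0

private
  _⁺++_ : ℕ → List Sign → List Sign
  k ⁺++ v = List.replicate k Sign.+ List.++ v

  _⁻++_ : ℕ → List Sign → List Sign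
  k ⁻++ v = List.replicate k Sign.- List.++ v

  -- The block lengths of +ᵗ -ʳ⁺¹ +ˢ can be read off from the word.
  minus-run : ∀ r r′ {s s′} →
              r ⁻++ List.replicate s Sign.+ ≡ r′ ⁻++ List.replicate s′ Sign.+ → r ≡ r′
  minus-run zero    zero     _  = refl
  minus-run zero    (suc r′) {zero} ()
  minus-run zero    (suc r′) {suc s} ()
  minus-run (suc r) zero     {s′ = zero} ()
  minus-run (suc r) zero     {s′ = suc s} ()
  minus-run (suc r) (suc r′) eq = cong suc (minus-run r r′ (List.∷-injectiveʳ eq))

  no-minus : ∀ s t r {v} → List.replicate s Sign.+ ≢ t ⁺++ (suc r ⁻++ v)
  no-minus zero    zero    r ()
  no-minus zero    (suc t) r ()
  no-minus (suc s) zero    r ()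
  no-minus (suc s) (suc t) r eq = no-minus s t r (List.∷-injectiveʳ eq)

  plus-run : ∀ t t′ r r′ {v v′} →
             t ⁺++ (suc r ⁻++ v) ≡ t′ ⁺++ (suc r′ ⁻++ v′) →
             t ≡ t′ × suc r ⁻++ v ≡ suc r′ ⁻++ v′
  plus-run zero    zero     r r′ eq = refl , eq
  plus-run zero    (suc t′) r r′ ()
  plus-run (suc t) zero     r r′ ()
  plus-run (suc t) (suc t′) r r′ eq with plus-run t t′ r r′ (List.∷-injectiveʳ eq)
  ... | t≡t′ , eq′ = cong suc t≡t′ , eq′

Shape-unique : ∀ {n} {w : Vec Sign n} (p q : Shape w) →
               Shape.t p ≡ Shape.t q × Shape.r p ≡ Shape.r q
Shape-unique {n} {w} p q =
  go (Shape.t p) (Shape.r p) (Shape.t q) (Shape.r q)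
     (Shape.all-plus p) (Shape.all-plus q) (trans (sym (Shape.word p)) (Shape.word q))
  where
  go : ∀ t r t′ r′ {s s′} → (r ≡ 0 → t ≡ 0) → (r′ ≡ 0 → t′ ≡ 0) →
       t ⁺++ (r ⁻++ List.replicate s Sign.+) ≡ t′ ⁺++ (r′ ⁻++ List.replicate s′ Sign.+) →
       t ≡ t′ × r ≡ r′
  go t zero t′ zero h h′ _ = trans (h refl) (sym (h′ refl)) , refl
  go t zero t′ (suc r′) {s} h h′ eq rewrite h refl = contradiction eq (no-minus s t′ r′)
  go t (suc r) t′ zero {s′ = s′} h h′ eq rewrite h′ refl =
    contradiction (sym eq) (no-minus s′ t r)
  go t (suc r) t′ (suc r′) h h′ eq with plus-run t t′ r r′ eq
  ... | t≡t′ , eq′ = t≡t′ , minus-run (suc r) (suc r′) eq′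

private
  NoDrop : ∀ {n} → Vec Sign n → Set
  NoDrop w = ∀ {j k} → j Fin.< k →
             Vec.lookup w j ≡ Sign.+ → Vec.lookup w k ≡ Sign.- → ⊥

  NoMPM : ∀ {n} → Vec Sign n → Set
  NoMPM w = ∀ {i j k} → i Fin.< j → j Fin.< k → Vec.lookup w i ≡ Sign.- →
            Vec.lookup w j ≡ Sign.+ → Vec.lookup w k ≡ Sign.- → ⊥

  plusTail : ∀ {n} (w : Vec Sign n) → (∀ k → Vec.lookup w k ≢ Sign.-) →
             toList w ≡ List.replicate n Sign.+
  plusTail []           h = refl
  plusTail (Sign.- ∷ w) h = contradiction refl (h zero)
  plusTail (Sign.+ ∷ w) h = cong (Sign.+ List.∷_) (plusTail w (h ∘ suc))

  minusPlus : ∀ {n} (w : Vec Sign n) → NoDrop w →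
              ∃[ r ] ∃[ s ] (r ℕ.+ s ≡ n × toList w ≡ r ⁻++ List.replicate s Sign.+)
  minusPlus [] h = 0 , 0 , refl , refl
  minusPlus (Sign.+ ∷ w) h = 0 , _ , refl ,
    cong (Sign.+ List.∷_) (plusTail w (λ k → h {zero} {suc k} (s≤s z≤n) refl))
  minusPlus (Sign.- ∷ w) h with minusPlus w (λ {j} {k} j<k → h {suc j} {suc k} (s≤s j<k))
  ... | r , s , r+s≡n , eq = suc r , s , cong suc r+s≡n , cong (Sign.- List.∷_) eq

  blocks : ∀ {n} (w : Vec Sign n) → NoMPM w →
           ∃[ t ] ∃[ r ] ∃[ s ] (t ℕ.+ (r ℕ.+ s) ≡ n × (r ≡ 0 → t ≡ 0) ×
             toList w ≡ t ⁺++ (r ⁻++ List.replicate s Sign.+))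
  blocks [] h = 0 , 0 , 0 , refl , (λ _ → refl) , refl
  blocks (Sign.- ∷ w) h
    with minusPlus w (λ {j} {k} j<k → h {zero} {suc j} {suc k} (s≤s z≤n) (s≤s j<k) refl)
  ... | r , s , r+s≡n , eq =
    0 , suc r , s , cong suc r+s≡n , (λ ()) , cong (Sign.- List.∷_) eq
  blocks (Sign.+ ∷ w) h
    with blocks w (λ {i} {j} {k} i<j j<k → h {suc i} {suc j} {suc k} (s≤s i<j) (s≤s j<k))
  ... | t , suc r , s , len , _ , eq =
    suc t , suc r , s , cong suc len , (λ ()) , cong (Sign.+ List.∷_) eq
  ... | t , zero , s , len , t≡0 , eq rewrite t≡0 refl =
    0 , 0 , suc s , cong suc len , (λ _ → refl) , cong (Sign.+ List.∷_) eq

  fromNoMPM : ∀ {n} (w : Vec Sign n) → NoMPM w → Shape w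
  fromNoMPM w h with blocks w h
  ... | t , r , s , refl , all-plus , eq = record
    { t = t ; r = r
    ; r+t≤n = subst (r ℕ.+ t ℕ.≤_) swap (ℕ.m≤m+n (r ℕ.+ t) s)
    ; word = trans eq (cong (λ k → t ⁺++ (r ⁻++ List.replicate k Sign.+)) (sym rest))
    ; all-plus = all-plus
    }
    where
    swap : r ℕ.+ t ℕ.+ s ≡ t ℕ.+ (r ℕ.+ s)
    swap = trans (cong (ℕ._+ s) (ℕ.+-comm r t)) (ℕ.+-assoc t r s)
    rest : t ℕ.+ (r ℕ.+ s) ∸ r ∸ t ≡ s
    rest = trans (ℕ.∸-+-assoc _ r t)
             (trans (cong (_∸ (r ℕ.+ t)) (sym swap)) (ℕ.m+n∸m≡n (r ℕ.+ t) s))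

ℕ⇒ℚ-+ : ∀ m n → ℕ⇒ℚ (m ℕ.+ n) ≡ ℕ⇒ℚ m ℚ.+ ℕ⇒ℚ n
ℕ⇒ℚ-+ m n = ℚ.toℚᵘ-injective (begin
  ℚ.toℚᵘ (ℕ⇒ℚ (m ℕ.+ n))                 ≈⟨ ℚ.toℚᵘ-fromℚᵘ (int (m ℕ.+ n)) ⟩
  int (m ℕ.+ n)                          ≈⟨ ℚᵘ.*≡* (cong (ℤ._* (ℤ.+ 1)) numerators) ⟩
  int m ℚᵘ.+ int n                       ≈⟨ ℚᵘ.+-cong (ℚ.toℚᵘ-fromℚᵘ (int m)) (ℚ.toℚᵘ-fromℚᵘ (int n)) ⟨
  ℚ.toℚᵘ (ℕ⇒ℚ m) ℚᵘ.+ ℚ.toℚᵘ (ℕ⇒ℚ n)     ≈⟨ ℚ.toℚᵘ-homo-+ (ℕ⇒ℚ m) (ℕ⇒ℚ n) ⟨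
  ℚ.toℚᵘ (ℕ⇒ℚ m ℚ.+ ℕ⇒ℚ n)               ∎)
  where
  open ℚᵘ.≃-Reasoning
  int : ℕ → ℚᵘ.ℚᵘ
  int k = ℚᵘ.mkℚᵘ (ℤ.+ k) 0
  numerators : ℤ.+ (m ℕ.+ n) ≡ (ℤ.+ m) ℤ.* (ℤ.+ 1) ℤ.+ (ℤ.+ n) ℤ.* (ℤ.+ 1)
  numerators = sym (cong₂ ℤ._+_ (ℤ.*-identityʳ (ℤ.+ m)) (ℤ.*-identityʳ (ℤ.+ n)))

ℕ⇒ℚ-* : ∀ m n → ℕ⇒ℚ (m ℕ.* n) ≡ ℕ⇒ℚ m ℚ.* ℕ⇒ℚ n
ℕ⇒ℚ-* m n = ℚ.toℚᵘ-injective (begin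
  ℚ.toℚᵘ (ℕ⇒ℚ (m ℕ.* n))                 ≈⟨ ℚ.toℚᵘ-fromℚᵘ (int (m ℕ.* n)) ⟩
  int (m ℕ.* n)                          ≈⟨ ℚᵘ.*≡* (cong (ℤ._* (ℤ.+ 1)) (ℤ.pos-* m n)) ⟩
  int m ℚᵘ.* int n                       ≈⟨ ℚᵘ.*-cong (ℚ.toℚᵘ-fromℚᵘ (int m)) (ℚ.toℚᵘ-fromℚᵘ (int n)) ⟨
  ℚ.toℚᵘ (ℕ⇒ℚ m) ℚᵘ.* ℚ.toℚᵘ (ℕ⇒ℚ n)     ≈⟨ ℚ.toℚᵘ-homo-* (ℕ⇒ℚ m) (ℕ⇒ℚ n) ⟨
  ℚ.toℚᵘ (ℕ⇒ℚ m ℚ.* ℕ⇒ℚ n)               ∎)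
  where
  open ℚᵘ.≃-Reasoning
  int : ℕ → ℚᵘ.ℚᵘ
  int k = ℚᵘ.mkℚᵘ (ℤ.+ k) 0

ℕ⇒ℚ-² : ∀ m → ℕ⇒ℚ (m ℕ.^ 2) ≡ ℕ⇒ℚ m ℚ.* ℕ⇒ℚ m
ℕ⇒ℚ-² m = trans (cong ℕ⇒ℚ (cong (m ℕ.*_) (ℕ.*-identityʳ m))) (ℕ⇒ℚ-* m m)

ℕ⇒ℚ-pos : ∀ m .{{_ : ℕ.NonZero m}} → 0ℚ ℚ.< ℕ⇒ℚ m
ℕ⇒ℚ-pos m = ℚ.positive⁻¹ (ℕ⇒ℚ m) {{ℚ.normalize-pos m 1}}

quadratic : (a x y : ℚ) → ℚ
quadratic a x y = 1ℚ ℚ.+ a ℚ.* x ℚ.+ a ℚ.* a ℚ.* y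

-- The third divided difference of a quadratic over the nodes
-- 0 , a , a + d , a + d + e vanishes; here with denominators cleared.
no-mpm : ∀ a d e x y → 0ℚ ℚ.< a → 0ℚ ℚ.< d → 0ℚ ℚ.< e →
         quadratic a x y ℚ.< 0ℚ → 0ℚ ℚ.< quadratic (a ℚ.+ d) x y →
         ¬ quadratic (a ℚ.+ d ℚ.+ e) x y ℚ.< 0ℚ
no-mpm a d e x y a>0 d>0 e>0 f<0 g>0 h<0 =
  ℚ.<-asym lhs<0 (subst (0ℚ ℚ.<_) (sym (identity a d e x y)) rhs>0)
  where
  open +-*-Solver
  j k d+e : ℚ
  j   = a ℚ.+ d
  k   = a ℚ.+ d ℚ.+ e
  d+e = d ℚ.+ e
  j>0 : 0ℚ ℚ.< j
  j>0 = ℚ.+-mono-< a>0 d>0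
  k>0 : 0ℚ ℚ.< k
  k>0 = ℚ.+-mono-< j>0 e>0
  d+e>0 : 0ℚ ℚ.< d+e
  d+e>0 = ℚ.+-mono-< d>0 e>0
  pos*pos : ∀ p q → 0ℚ ℚ.< p → 0ℚ ℚ.< q → 0ℚ ℚ.< p ℚ.* q
  pos*pos p q p>0 q>0 = ℚ.positive⁻¹ _ {{ℚ.pos*pos⇒pos p {{positive p>0}} q {{positive q>0}}}}
  pos*neg : ∀ p q → 0ℚ ℚ.< p → q ℚ.< 0ℚ → p ℚ.* q ℚ.< 0ℚ
  pos*neg p q p>0 q<0 = ℚ.negative⁻¹ _ {{ℚ.pos*neg⇒neg p {{positive p>0}} q {{negative q<0}}}}
  triple : ∀ p q r → 0ℚ ℚ.< p → 0ℚ ℚ.< q → 0ℚ ℚ.< r → 0ℚ ℚ.< p ℚ.* q ℚ.* r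
  triple p q r p>0 q>0 r>0 = pos*pos (p ℚ.* q) r (pos*pos p q p>0 q>0) r>0
  lhs<0 : j ℚ.* k ℚ.* e ℚ.* quadratic a x y ℚ.+ a ℚ.* j ℚ.* d ℚ.* quadratic k x y ℚ.< 0ℚ
  lhs<0 = ℚ.+-mono-<
    (pos*neg (j ℚ.* k ℚ.* e) (quadratic a x y) (triple j k e j>0 k>0 e>0) f<0)
    (pos*neg (a ℚ.* j ℚ.* d) (quadratic k x y) (triple a j d a>0 j>0 d>0) h<0)
  rhs>0 : 0ℚ ℚ.< d ℚ.* d+e ℚ.* e ℚ.+ a ℚ.* k ℚ.* d+e ℚ.* quadratic j x y
  rhs>0 = ℚ.+-mono-<
    (triple d d+e e d>0 d+e>0 e>0)
    (pos*pos (a ℚ.* k ℚ.* d+e) (quadratic j x y) (triple a k d+e a>0 k>0 d+e>0) g>0)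
  identity : ∀ a d e x y →
    (a ℚ.+ d) ℚ.* (a ℚ.+ d ℚ.+ e) ℚ.* e ℚ.* quadratic a x y
      ℚ.+ a ℚ.* (a ℚ.+ d) ℚ.* d ℚ.* quadratic (a ℚ.+ d ℚ.+ e) x y ≡
    d ℚ.* (d ℚ.+ e) ℚ.* e
      ℚ.+ a ℚ.* (a ℚ.+ d ℚ.+ e) ℚ.* (d ℚ.+ e) ℚ.* quadratic (a ℚ.+ d) x y
  identity = solve 5 (λ a d e x y →
    let q : _ → _
        q = λ b → con 1ℚ :+ b :* x :+ b :* b :* y in
    (a :+ d) :* (a :+ d :+ e) :* e :* q a :+ a :* (a :+ d) :* d :* q (a :+ d :+ e)
    := d :* (d :+ e) :* e :+ a :* (a :+ d :+ e) :* (d :+ e) :* q (a :+ d)) refl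

Eventually : Pred ℕ 0ℓ → Set
Eventually P = ∃[ N ] (∀ n → N ℕ.≤ n → P n)

minus-eventually : ∀ {x} (h : x # fromℕ 0) → sgn h ≡ Sign.- →
                   Eventually (λ n → seq x n ℚ.< 0ℚ)
minus-eventually {x} (inj₁ (gap δ δ>0 N h)) _ = N , λ n N≤n →
  ℚ.<-≤-trans
    (subst (ℚ._< seq x n ℚ.+ δ) (ℚ.+-identityʳ (seq x n)) (ℚ.+-monoʳ-< (seq x n) δ>0))
    (h n N≤n)

plus-eventually : ∀ {x} (h : x # fromℕ 0) → sgn h ≡ Sign.+ →
                  Eventually (λ n → 0ℚ ℚ.< seq x n)
plus-eventually {x} (inj₂ (gap δ δ>0 N h)) _ = N , λ n N≤n →
  ℚ.<-≤-trans δ>0 (subst (ℚ._≤ seq x n) (ℚ.+-identityˡ δ) (h n N≤n))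

seq-ℓ : ∀ i x₁ x₂ n → seq (ℓ i (x₁ , x₂)) n ≡ quadratic (ℕ⇒ℚ i) (seq x₁ n) (seq x₂ n)
seq-ℓ i x₁ x₂ n =
  cong (λ c → 1ℚ ℚ.+ ℕ⇒ℚ i ℚ.* seq x₁ n ℚ.+ c ℚ.* seq x₂ n) (ℕ⇒ℚ-² i)

NoMPM-at : ∀ i j k x₁ x₂ n → 0 ℕ.< i → i ℕ.< j → j ℕ.< k →
           seq (ℓ i (x₁ , x₂)) n ℚ.< 0ℚ → 0ℚ ℚ.< seq (ℓ j (x₁ , x₂)) n →
           ¬ seq (ℓ k (x₁ , x₂)) n ℚ.< 0ℚ
NoMPM-at i j k x₁ x₂ n 0<i i<j j<k f<0 g>0 h<0 =
  no-mpm (ℕ⇒ℚ i) (ℕ⇒ℚ (j ∸ i)) (ℕ⇒ℚ (k ∸ j)) (seq x₁ n) (seq x₂ n)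
    (ℕ⇒ℚ-pos i {{ℕ.>-nonZero 0<i}})
    (ℕ⇒ℚ-pos (j ∸ i) {{ℕ.>-nonZero (ℕ.m<n⇒0<n∸m i<j)}})
    (ℕ⇒ℚ-pos (k ∸ j) {{ℕ.>-nonZero (ℕ.m<n⇒0<n∸m j<k)}})
    (subst (ℚ._< 0ℚ) (seq-ℓ i x₁ x₂ n) f<0)
    (subst (0ℚ ℚ.<_) (trans (seq-ℓ j x₁ x₂ n) (cong Q split-j)) g>0)
    (subst (ℚ._< 0ℚ) (trans (seq-ℓ k x₁ x₂ n) (cong Q split-k)) h<0)
  where
  Q : ℚ → ℚ
  Q a = quadratic a (seq x₁ n) (seq x₂ n)
  split : ∀ {p q} → p ℕ.< q → ℕ⇒ℚ q ≡ ℕ⇒ℚ p ℚ.+ ℕ⇒ℚ (q ∸ p)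
  split {p} {q} p<q =
    trans (cong ℕ⇒ℚ (sym (ℕ.m+[n∸m]≡n (ℕ.<⇒≤ p<q)))) (ℕ⇒ℚ-+ p (q ∸ p))
  split-j : ℕ⇒ℚ j ≡ ℕ⇒ℚ i ℚ.+ ℕ⇒ℚ (j ∸ i)
  split-j = split i<j
  split-k : ℕ⇒ℚ k ≡ ℕ⇒ℚ i ℚ.+ ℕ⇒ℚ (j ∸ i) ℚ.+ ℕ⇒ℚ (k ∸ j)
  split-k = trans (split j<k) (cong (ℚ._+ ℕ⇒ℚ (k ∸ j)) split-j)

σ-NoMPM : ∀ {n} (x : Point n) → NoMPM (σ x)
σ-NoMPM x {i} {j} {k} i<j j<k σi σj σk =
  NoMPM-at (suc (toℕ i)) (suc (toℕ j)) (suc (toℕ k))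
    (proj₁ (coords x)) (proj₂ (coords x)) M
    (s≤s z≤n) (s≤s i<j) (s≤s j<k)
    (proj₂ ei M (ℕ.m⊔n≤o⇒m≤o Ni Nj (ℕ.m≤m⊔n (Ni ℕ.⊔ Nj) Nk)))
    (proj₂ ej M (ℕ.m⊔n≤o⇒n≤o Ni Nj (ℕ.m≤m⊔n (Ni ℕ.⊔ Nj) Nk)))
    (proj₂ ek M (ℕ.m≤n⊔m (Ni ℕ.⊔ Nj) Nk))
  where
  sign : ∀ l → Vec.lookup (σ x) l ≡ sgn (off x l)
  sign = lookup∘tabulate (λ l → sgn (off x l))
  ei = minus-eventually (off x i) (trans (sym (sign i)) σi)
  ej = plus-eventually  (off x j) (trans (sym (sign j)) σj)
  ek = minus-eventually (off x k) (trans (sym (sign k)) σk)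
  Ni = proj₁ ei
  Nj = proj₁ ej
  Nk = proj₁ ek
  M  = Ni ℕ.⊔ Nj ℕ.⊔ Nk

shape : ∀ {n} (x : Point n) → Shape (σ x)
shape x = fromNoMPM (σ x) (σ-NoMPM x)

t r : ∀ {n} → Point n → ℕ
t x = Shape.t (shape x)
r x = Shape.r (shape x)

data Letter : Set where
  𝚊 𝚋 : Letter

_≟_ : DecidableEquality Letter
𝚊 ≟ 𝚊 = yes refl
𝚊 ≟ 𝚋 = no λ ()
𝚋 ≟ 𝚊 = no λ ()
𝚋 ≟ 𝚋 = yes refl

∣_∣[_] : ∀ {n} → Vec Letter n → Letter → ℕ
∣ w ∣[ x ] = count (x ≟_) w

-- The number of occurrences of u in w as a scattered subword.
binom : ∀ {m n} → Vec Letter n → Vec Letter m → ℕ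
binom w       []      = 1
binom []      (_ ∷ _) = 0
binom (x ∷ w) (y ∷ u) with x ≟ y
... | yes _ = binom w u ℕ.+ binom w (y ∷ u)
... | no  _ = binom w (y ∷ u)

strip : ∀ {n} → Vec Letter n → ℕ
strip w with ∣ w ∣[ 𝚊 ]
... | zero      = 0
... | k@(suc _) = binom w (𝚊 ∷ 𝚋 ∷ []) ℕ./ k

infix 4 _∼_

_∼_ : ∀ {n} → Vec Letter n → Vec Letter n → Set
u ∼ w = ∣ u ∣[ 𝚊 ] ≡ ∣ w ∣[ 𝚊 ] × strip u ≡ strip w

Words/∼ : ℕ → Setoid 0ℓ 0ℓ
Words/∼ n = record
  { Carrier       = Vec Letter n
  ; _≈_           = _∼_
  ; isEquivalence = record
    { refl  = refl , refl
    ; sym   = λ (p , q) → sym p , sym q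
    ; trans = λ (p , q) (p′ , q′) → trans p p′ , trans q q′
    }
  }

-- A representative of the class Ψ(C), computed from a point of C.
Ψ : ∀ n → Point n → Vec Letter n
Ψ n x = cast length≡n
  (replicate (n ∸ r x ∸ t x) 𝚋 ++ replicate (r x) 𝚊 ++ replicate (t x) 𝚋)
  where
  length≡n : n ∸ r x ∸ t x ℕ.+ (r x ℕ.+ t x) ≡ n
  length≡n = trans (cong (ℕ._+ (r x ℕ.+ t x)) (ℕ.∸-+-assoc n (r x) (t x)))
                   (ℕ.m∸n+n≡m (Shape.r+t≤n (shape x)))

{-# OPTIONS --safe #-}

-- The sign word of a point determines its chamber and vice versa: the half-planes ℓ i > 0 and
-- ℓ i < 0 are open and separate any connected set meeting both, while a cell with prescribed
-- signs is convex, hence connected by bisecting a segment.  So a chamber is a pair (t , r), and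
-- the word bⁿ⁻ʳ⁻ᵗ aʳ bᵗ has r letters a and strip t, because each a is followed by exactly t
-- letters b.  All pairs with r + t ≤ n (and t = 0 if r = 0) occur on both sides: strip w is at
-- most the number of letters b, and i ↦ (1 - i / (t + ½)) (1 - i / (t + r + ½)) has the signs
-- +ᵗ -ʳ +ⁿ⁻ʳ⁻ᵗ at i = 1 , … , n.
module Submission where

open import Defs
open import Data.Empty using (⊥; ⊥-elim)
open import Data.Fin using (Fin; toℕ)
import Data.Integer as ℤ
import Data.Integer.Properties as ℤ
import Data.List as List
open import Data.Nat as ℕ using (ℕ; zero; suc; NonZero)
import Data.Nat.DivMod as ℕ
import Data.Nat.Properties as ℕ
open import Data.Product using (_×_; _,_; proj₁; proj₂; ∃-syntax; Σ-syntax)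
open import Data.Rational as ℚ using (ℚ; mkℚ; 0ℚ; 1ℚ; ½; ∣_∣; positive; nonNegative)
import Data.Rational.Properties as ℚ
open import Data.Rational.Solver using (module +-*-Solver)
import Data.Rational.Unnormalised as ℚᵘ
import Data.Rational.Unnormalised.Properties as ℚᵘ
open import Data.Sign as Sign using (Sign)
open import Data.Sum using (_⊎_; inj₁; inj₂)
open import Data.Vec using (Vec; []; _∷_; _++_; replicate; cast; lookup; tabulate; toList)
open import Data.Vec.Properties using (cast-is-id; lookup∘tabulate; tabulate-cong; toList-injective)
open import Function.Structures using (IsBijection)
open import Level using (0ℓ)
open import Relation.Binary.Bundles using (Setoid)
open import Relation.Binary.PropositionalEquality
open import Relation.Nullary using (contradiction)
open import Relation.Unary using (Pred; _∈_; _⊆_)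

open +-*-Solver using (solve; _:=_; _:+_; _:*_; _:-_; :-_; con)

-- Rational estimates

-- Splits an inequality into a visibly nonnegative difference and a ring identity. Many estimates
-- below take this form, with the identity left to `solve`.
≤-witness : ∀ {p q} d → 0ℚ ℚ.≤ d → q ≡ p ℚ.+ d → p ℚ.≤ q
≤-witness {p} d d≥0 refl = subst (ℚ._≤ p ℚ.+ d) (ℚ.+-identityʳ p) (ℚ.+-monoʳ-≤ p d≥0)

p≤q⇒0≤q-p : ∀ {p q} → p ℚ.≤ q → 0ℚ ℚ.≤ q ℚ.- p
p≤q⇒0≤q-p {p} {q} p≤q = subst (ℚ._≤ q ℚ.- p) (ℚ.+-inverseʳ p) (ℚ.+-monoˡ-≤ (ℚ.- p) p≤q)

0≤p*q : ∀ {p q} → 0ℚ ℚ.≤ p → 0ℚ ℚ.≤ q → 0ℚ ℚ.≤ p ℚ.* q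
0≤p*q {p} {q} p≥0 q≥0 =
  ℚ.nonNegative⁻¹ _ {{ℚ.nonNeg*nonNeg⇒nonNeg p {{nonNegative p≥0}} q {{nonNegative q≥0}}}}

0<p*q : ∀ {p q} → 0ℚ ℚ.< p → 0ℚ ℚ.< q → 0ℚ ℚ.< p ℚ.* q
0<p*q {p} {q} p>0 q>0 =
  ℚ.positive⁻¹ _ {{ℚ.pos*pos⇒pos p {{positive p>0}} q {{positive q>0}}}}

0<½ : 0ℚ ℚ.< ½
0<½ = ℚ.positive⁻¹ ½

∣p∣-lub : ∀ {p q} → p ℚ.≤ q → ℚ.- p ℚ.≤ q → ∣ p ∣ ℚ.≤ q
∣p∣-lub {p} {q} p≤q -p≤q with ℚ.∣p∣≡p∨∣p∣≡-p p
... | inj₁ eq = subst (ℚ._≤ q) (sym eq) p≤q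
... | inj₂ eq = subst (ℚ._≤ q) (sym eq) -p≤q

p≤∣p∣ : ∀ p → p ℚ.≤ ∣ p ∣
p≤∣p∣ p with ℚ.≤-total 0ℚ p
... | inj₁ p≥0 = ℚ.≤-reflexive (sym (ℚ.0≤p⇒∣p∣≡p p≥0))
... | inj₂ p≤0 = ℚ.≤-trans p≤0 (ℚ.nonNegative⁻¹ ∣ p ∣ {{ℚ.∣-∣-nonNeg p}})

reciprocal : ∀ p → 0ℚ ℚ.< p → ∃[ q ] (0ℚ ℚ.< q × p ℚ.* q ≡ 1ℚ)
reciprocal p p>0 =
  ℚ.1/_ p {{nz}} , ℚ.positive⁻¹ _ {{ℚ.1/pos⇒pos p {{positive p>0}}}} , ℚ.*-inverseʳ p {{nz}}
  where
  nz = ℚ.pos⇒nonZero p {{positive p>0}}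

-- Only half of `ε` is spent, so that room remains for a strict inequality or a positive margin.
shrink : ∀ p ε → 0ℚ ℚ.< p → 0ℚ ℚ.< ε → ∃[ δ ] (0ℚ ℚ.< δ × p ℚ.* δ ≡ ½ ℚ.* ε)
shrink p ε p>0 ε>0 with reciprocal p p>0
... | q , q>0 , pq≡1 = q ℚ.* (½ ℚ.* ε) , 0<p*q q>0 (0<p*q 0<½ ε>0) , (begin
  p ℚ.* (q ℚ.* (½ ℚ.* ε)) ≡⟨ ℚ.*-assoc p q (½ ℚ.* ε) ⟨
  p ℚ.* q ℚ.* (½ ℚ.* ε)   ≡⟨ cong (ℚ._* (½ ℚ.* ε)) pq≡1 ⟩
  1ℚ ℚ.* (½ ℚ.* ε)        ≡⟨ ℚ.*-identityˡ (½ ℚ.* ε) ⟩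
  ½ ℚ.* ε                 ∎)
  where open ≡-Reasoning

½*ε<ε : ∀ {ε} → 0ℚ ℚ.< ε → ½ ℚ.* ε ℚ.< ε
½*ε<ε {ε} ε>0 = subst (½ ℚ.* ε ℚ.<_) (ℚ.*-identityˡ ε)
  (ℚ.*-monoˡ-<-pos ε {{positive ε>0}} {½} {1ℚ} (ℚ.*<* (ℤ.+<+ (ℕ.s≤s (ℕ.s≤s ℕ.z≤n)))))

0≤ℕ⇒ℚ : ∀ n → 0ℚ ℚ.≤ ℕ⇒ℚ n
0≤ℕ⇒ℚ n = ℚ.nonNegative⁻¹ (ℕ⇒ℚ n) {{ℚ.normalize-nonNeg n 1}}

-- The denominator of `ε` serves as `N`: the product is then the numerator, a positive integer.
archimedean : ∀ ε → 0ℚ ℚ.< ε → ∃[ N ] 1ℚ ℚ.≤ ε ℚ.* ℕ⇒ℚ N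
archimedean ε@(mkℚ (ℤ.+ suc p) d _) _ = suc d , ℚ.toℚᵘ-cancel-≤ (begin
  ℚ.toℚᵘ 1ℚ                                  ≤⟨ ℚᵘ.*≤* bound ⟩
  ℚ.toℚᵘ ε ℚᵘ.* ℚᵘ.mkℚᵘ (ℤ.+ suc d) 0        ≃⟨ ℚᵘ.*-cong {ℚ.toℚᵘ ε} ℚᵘ.≃-refl (ℚ.toℚᵘ-fromℚᵘ (ℚᵘ.mkℚᵘ (ℤ.+ suc d) 0)) ⟨
  ℚ.toℚᵘ ε ℚᵘ.* ℚ.toℚᵘ (ℕ⇒ℚ (suc d))         ≃⟨ ℚ.toℚᵘ-homo-* ε (ℕ⇒ℚ (suc d)) ⟨
  ℚ.toℚᵘ (ε ℚ.* ℕ⇒ℚ (suc d))                 ∎)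
  where
  open ℚᵘ.≤-Reasoning
  bound : ℤ.+ 1 ℤ.* ℤ.+ (suc d ℕ.* 1) ℤ.≤ (ℤ.+ suc p ℤ.* ℤ.+ suc d) ℤ.* ℤ.+ 1
  bound = subst₂ ℤ._≤_ (sym (trans (ℤ.*-identityˡ _) (cong ℤ.+_ (ℕ.*-identityʳ (suc d)))))
    (sym (trans (ℤ.*-identityʳ _) (sym (ℤ.pos-* (suc p) (suc d)))))
    (ℤ.+≤+ (ℕ.m≤m+n (suc d) (p ℕ.* suc d)))
archimedean (mkℚ (ℤ.+ zero) _ _) (ℚ.*<* (ℤ.+<+ ()))
archimedean (mkℚ (ℤ.-[1+ _ ]) _ _) (ℚ.*<* ())

½^_ : ℕ → ℚ
½^ zero  = 1ℚ
½^ suc k = ½ ℚ.* ½^ k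

½^-pos : ∀ k → 0ℚ ℚ.< ½^ k
½^-pos zero    = ℚ.positive⁻¹ 1ℚ
½^-pos (suc k) = 0<p*q 0<½ (½^-pos k)

½^-≤1 : ∀ k → ½^ k ℚ.≤ 1ℚ
½^-≤1 zero    = ℚ.≤-refl
½^-≤1 (suc k) = ℚ.≤-trans (ℚ.<⇒≤ (½*ε<ε (½^-pos k))) (½^-≤1 k)

-- A weighted form of `k < 2ᵏ`; together with `archimedean` it makes the powers of ½ arbitrarily
-- small.
½^*k<1 : ∀ k → ½^ k ℚ.* ℕ⇒ℚ k ℚ.< 1ℚ
½^*k<1 zero    = ℚ.positive⁻¹ 1ℚ
½^*k<1 (suc k) = begin-strict
  ½ ℚ.* ½^ k ℚ.* ℕ⇒ℚ (suc k)          ≡⟨ cong (½ ℚ.* ½^ k ℚ.*_) (ℕ⇒ℚ-+ 1 k) ⟩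
  ½ ℚ.* ½^ k ℚ.* (1ℚ ℚ.+ ℕ⇒ℚ k)       ≡⟨ expand (½^ k) (ℕ⇒ℚ k) ⟩
  ½ ℚ.* (½^ k ℚ.+ ½^ k ℚ.* ℕ⇒ℚ k)     <⟨ ℚ.*-monoʳ-<-pos ½ (ℚ.+-mono-≤-< (½^-≤1 k) (½^*k<1 k)) ⟩
  ½ ℚ.* (1ℚ ℚ.+ 1ℚ)                   ≡⟨⟩
  1ℚ                                  ∎
  where
  open ℚ.≤-Reasoning
  expand : ∀ h m → ½ ℚ.* h ℚ.* (1ℚ ℚ.+ m) ≡ ½ ℚ.* (h ℚ.+ h ℚ.* m)
  expand = solve 2 (λ h m → con ½ :* h :* (con 1ℚ :+ m) := con ½ :* (h :+ h :* m)) refl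

½^-small : ∀ ε → 0ℚ ℚ.< ε → ∃[ k ] ½^ k ℚ.< ε
½^-small ε ε>0 with archimedean ε ε>0
... | N , 1≤εN = N , ℚ.*-cancelʳ-<-nonNeg (ℕ⇒ℚ N) {{nonNegative (0≤ℕ⇒ℚ N)}}
  (ℚ.<-≤-trans (½^*k<1 N) 1≤εN)

-- Eventual closeness of Cauchy sequences

infixr 7 _∩ᵉ_

_∩ᵉ_ : ∀ {P Q : Pred ℕ 0ℓ} → Eventually P → Eventually Q → Eventually (λ n → P n × Q n)
(M , p) ∩ᵉ (N , q) = M ℕ.⊔ N , λ n hn →
  p n (ℕ.m⊔n≤o⇒m≤o M N hn) , q n (ℕ.m⊔n≤o⇒n≤o M N hn)

mapᵉ : ∀ {P Q : Pred ℕ 0ℓ} → (∀ n → P n → Q n) → Eventually P → Eventually Q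
mapᵉ f (N , p) = N , λ n N≤n → f n (p n N≤n)

-- Non-strict because it is proved termwise. The uniform gap that `<` on reals demands is recovered
-- in `<+-close` from the slack between two radii.
Close : ℚ → ℝ → ℝ → Set
Close ε x y = Eventually (λ n → ∣ seq x n ℚ.- seq y n ∣ ℚ.≤ ε)

<+-close : ∀ {η ε x y} → η ℚ.< ε → Close η x y → x < y + fromℚ ε
<+-close {η} {ε} {x} {y} η<ε (N , close) =
  gap (ε ℚ.- η) (subst (ℚ._< ε ℚ.- η) (ℚ.+-inverseʳ η) (ℚ.+-monoˡ-< (ℚ.- η) η<ε)) N
  λ n N≤n → ≤-witness _ (p≤q⇒0≤q-p (ℚ.≤-trans (p≤∣p∣ (seq x n ℚ.- seq y n)) (close n N≤n)))
    (identity (seq x n) (seq y n) ε η)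
  where
  identity : ∀ x y ε η → y ℚ.+ ε ≡ x ℚ.+ (ε ℚ.- η) ℚ.+ (η ℚ.- (x ℚ.- y))
  identity = solve 4 (λ x y ε η → y :+ ε := x :+ (ε :- η) :+ (η :- (x :- y))) refl

close-sym : ∀ {η x y} → Close η x y → Close η y x
close-sym {η} {x} {y} = mapᵉ λ n → subst (ℚ._≤ η) (swap (seq x n) (seq y n))
  where
  swap : ∀ p q → ∣ p ℚ.- q ∣ ≡ ∣ q ℚ.- p ∣
  swap p q = trans (sym (ℚ.∣-p∣≡∣p∣ (p ℚ.- q))) (cong ∣_∣
    (solve 2 (λ p q → :- (p :- q) := q :- p) refl p q))

close-box : ∀ {η ε x₁ x₂ y₁ y₂} → η ℚ.< ε → Close η x₁ y₁ → Close η x₂ y₂ →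
            Box (x₁ , x₂) ε (y₁ , y₂)
close-box {x₁ = x₁} {x₂} {y₁} {y₂} η<ε c₁ c₂ =
  (<+-close {x = x₁} {y₁} η<ε c₁ , <+-close {x = y₁} {x₁} η<ε (close-sym {x = x₁} {y₁} c₁)) ,
  (<+-close {x = x₂} {y₂} η<ε c₂ , <+-close {x = y₂} {x₂} η<ε (close-sym {x = x₂} {y₂} c₂))

≗⇒close : ∀ {η x y} → 0ℚ ℚ.≤ η → (∀ n → seq x n ≡ seq y n) → Close η x y
≗⇒close {η} {x} {y} η≥0 eq = 0 , λ n _ → subst (ℚ._≤ η)
  (sym (cong ∣_∣ (trans (cong (ℚ._- seq y n) (eq n)) (ℚ.+-inverseʳ (seq y n))))) η≥0

-- Termwise equal sequences may still differ as elements of `ℝ` through their Cauchy moduli, but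
-- they lie in each other's boxes of every positive radius.
open-resp : ∀ {U x₁ x₂ y₁ y₂} → Open U → (∀ n → seq x₁ n ≡ seq y₁ n) → (∀ n → seq x₂ n ≡ seq y₂ n) →
            (x₁ , x₂) ∈ U → (y₁ , y₂) ∈ U
open-resp {x₁ = x₁} {x₂} {y₁} {y₂} openU eq₁ eq₂ x∈U with openU x∈U
... | ε , ε>0 , box⊆U = box⊆U (close-box {0ℚ} {ε} {x₁} {x₂} {y₁} {y₂} ε>0
  (≗⇒close {x = x₁} {y₁} ℚ.≤-refl eq₁) (≗⇒close {x = x₂} {y₂} ℚ.≤-refl eq₂))

eventually-bounded : ∀ x → ∃[ B ] (0ℚ ℚ.< B × Eventually (λ n → ∣ seq x n ∣ ℚ.≤ B))
eventually-bounded x with cauchy x 1ℚ (ℚ.positive⁻¹ 1ℚ)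
... | N , close = 1ℚ ℚ.+ ∣ seq x N ∣ , ℚ.+-mono-<-≤ (ℚ.positive⁻¹ 1ℚ) (ℚ.0≤∣p∣ (seq x N)) , N
  , λ n N≤n → begin
  ∣ seq x n ∣                               ≡⟨ cong ∣_∣ (split (seq x n) (seq x N)) ⟩
  ∣ (seq x n ℚ.- seq x N) ℚ.+ seq x N ∣     ≤⟨ ℚ.∣p+q∣≤∣p∣+∣q∣ (seq x n ℚ.- seq x N) (seq x N) ⟩
  ∣ seq x n ℚ.- seq x N ∣ ℚ.+ ∣ seq x N ∣   ≤⟨ ℚ.+-monoˡ-≤ ∣ seq x N ∣ (ℚ.<⇒≤ (close n N N≤n ℕ.≤-refl)) ⟩
  1ℚ ℚ.+ ∣ seq x N ∣                        ∎
  where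
  open ℚ.≤-Reasoning
  split : ∀ a b → a ≡ (a ℚ.- b) ℚ.+ b
  split = solve 2 (λ a b → a := (a :- b) :+ b) refl

-- Bisection and convex sets

-- Bounding every term keeps the convexity estimates termwise; the rational constants and the limit
-- met in the bisection satisfy such bounds.
UnitInterval : Pred ℝ 0ℓ
UnitInterval c = ∀ n → 0ℚ ℚ.≤ seq c n × seq c n ℚ.≤ 1ℚ

Open₁ : Pred ℝ 0ℓ → Set
Open₁ A = ∀ {c} → c ∈ A → ∃[ ε ] (0ℚ ℚ.< ε × (∀ {d} → Close ε c d → d ∈ A))

-- Bisection is constructive here because the cover decides, for each midpoint, on which side it lies.
module Bisection
  {A B : Pred ℝ 0ℓ} (openA : Open₁ A) (openB : Open₁ B)
  (cover : ∀ {c} → c ∈ UnitInterval → c ∈ A ⊎ c ∈ B)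
  (disjoint : ∀ {c} → c ∈ UnitInterval → c ∈ A → c ∈ B → ⊥)
  (0∈A : fromℚ 0ℚ ∈ A) (1∈B : fromℚ 1ℚ ∈ B)
  where

  record Stage (k : ℕ) : Set where
    field
      left    : ℚ
    -- Defined rather than stored, so that the width is `½^ k` by construction.
    right = left ℚ.+ ½^ k
    field
      left∈A  : fromℚ left ∈ A
      right∈B : fromℚ right ∈ B
      0≤left  : 0ℚ ℚ.≤ left
      right≤1 : right ℚ.≤ 1ℚ

  open Stage

  left≤right : ∀ {k} (s : Stage k) → left s ℚ.≤ right s
  left≤right {k} s = ≤-witness (½^ k) (ℚ.<⇒≤ (½^-pos k)) refl

  Refines : ∀ {k l} → Stage k → Stage l → Set
  Refines s s′ = left s ℚ.≤ left s′ × right s′ ℚ.≤ right s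

  left≤mid : ∀ {k} (s : Stage k) → left s ℚ.≤ left s ℚ.+ ½^ (suc k)
  left≤mid {k} s = ≤-witness (½^ (suc k)) (ℚ.<⇒≤ (½^-pos (suc k))) refl

  mid≤right : ∀ {k} (s : Stage k) → left s ℚ.+ ½^ (suc k) ℚ.≤ right s
  mid≤right {k} s = ℚ.+-monoʳ-≤ (left s) (ℚ.<⇒≤ (½*ε<ε (½^-pos k)))

  -- When the right half is kept, its right end has to be presented as the new left end plus the new
  -- width.
  right≡mid+½^ : ∀ {k} (s : Stage k) → right s ≡ left s ℚ.+ ½^ (suc k) ℚ.+ ½^ (suc k)
  right≡mid+½^ {k} s = solve 2 (λ a h → a :+ h := a :+ con ½ :* h :+ con ½ :* h) refl (left s) (½^ k)

  refine : ∀ {k} (s : Stage k) → Σ[ s′ ∈ Stage (suc k) ] Refines s s′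
  refine {k} s with cover {fromℚ (left s ℚ.+ ½^ (suc k))}
    (λ _ → ℚ.≤-trans (0≤left s) (left≤mid s) , ℚ.≤-trans (mid≤right s) (right≤1 s))
  ... | inj₁ mid∈A = record
    { left    = left s ℚ.+ ½^ (suc k)
    ; left∈A  = mid∈A
    ; right∈B = subst (λ q → fromℚ q ∈ B) (right≡mid+½^ s) (right∈B s)
    ; 0≤left  = ℚ.≤-trans (0≤left s) (left≤mid s)
    ; right≤1 = subst (ℚ._≤ 1ℚ) (right≡mid+½^ s) (right≤1 s)
    } , left≤mid s , ℚ.≤-reflexive (sym (right≡mid+½^ s))
  ... | inj₂ mid∈B = record
    { left    = left s
    ; left∈A  = left∈A s
    ; right∈B = mid∈B
    ; 0≤left  = 0≤left s
    ; right≤1 = ℚ.≤-trans (mid≤right s) (right≤1 s)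
    } , ℚ.≤-refl , mid≤right s

  stage : ∀ k → Stage k
  stage zero    = record
    { left = 0ℚ ; left∈A = 0∈A ; right∈B = 1∈B ; 0≤left = ℚ.≤-refl ; right≤1 = ℚ.≤-refl }
  stage (suc k) = proj₁ (refine (stage k))

  -- `≤′` grows at its upper end, which matches the recursion of `stage`.
  stage-refines : ∀ {k l} → k ℕ.≤′ l → Refines (stage k) (stage l)
  stage-refines ℕ.≤′-refl = ℚ.≤-refl , ℚ.≤-refl
  stage-refines {l = suc l} (ℕ.≤′-step k≤l)
    with stage-refines k≤l | proj₂ (refine (stage l))
  ... | left≤ , ≤right | left≤′ , ≤′right = ℚ.≤-trans left≤ left≤′ , ℚ.≤-trans ≤′right ≤right

  within : ∀ k l → k ℕ.≤ l → left (stage k) ℚ.≤ left (stage l) × left (stage l) ℚ.≤ right (stage k)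
  within k l k≤l with stage-refines (ℕ.≤⇒≤′ k≤l)
  ... | left≤ , ≤right = left≤ , ℚ.≤-trans (left≤right (stage l)) ≤right

  dist : ∀ {a h p q} → a ℚ.≤ p × p ℚ.≤ a ℚ.+ h → a ℚ.≤ q × q ℚ.≤ a ℚ.+ h → ∣ p ℚ.- q ∣ ℚ.≤ h
  dist {a} {h} {p} {q} (a≤p , p≤a+h) (a≤q , q≤a+h) = ∣p∣-lub
    (≤-witness _ (ℚ.+-mono-≤ (p≤q⇒0≤q-p p≤a+h) (p≤q⇒0≤q-p a≤q))
      (solve 4 (λ a h p q → h := (p :- q) :+ ((a :+ h :- p) :+ (q :- a))) refl a h p q))
    (≤-witness _ (ℚ.+-mono-≤ (p≤q⇒0≤q-p q≤a+h) (p≤q⇒0≤q-p a≤p))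
      (solve 4 (λ a h p q → h := :- (p :- q) :+ ((a :+ h :- q) :+ (p :- a))) refl a h p q))

  limit : ℝ
  limit = record
    { seq    = λ k → left (stage k)
    ; cauchy = λ ε ε>0 → let (K , ½^K<ε) = ½^-small ε ε>0 in K , λ m n K≤m K≤n →
        ℚ.≤-<-trans (dist {h = ½^ K} (within K m K≤m) (within K n K≤n)) ½^K<ε
    }

  limit∈I : limit ∈ UnitInterval
  limit∈I n = 0≤left (stage n) , ℚ.≤-trans (left≤right (stage n)) (right≤1 (stage n))

  -- Whichever side holds the limit is open, so it also holds both ends of a late enough stage; but
  -- one of these ends lies on the other side.
  absurd : ⊥
  absurd with cover {limit} limit∈I
  ... | inj₁ limit∈A with openA {limit} limit∈A
  ...   | ε , ε>0 , close⇒A with ½^-small ε ε>0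
  ...     | k , ½^k<ε = disjoint {fromℚ (right s)}
    (λ _ → ℚ.≤-trans (0≤left s) (left≤right s) , right≤1 s)
    (close⇒A (k , λ n k≤n → ℚ.≤-trans
      (dist (within k n k≤n) (left≤right s , ℚ.≤-refl)) (ℚ.<⇒≤ ½^k<ε)))
    (right∈B s)
    where s = stage k
  absurd | inj₂ limit∈B with openB {limit} limit∈B
  ...   | ε , ε>0 , close⇒B with ½^-small ε ε>0
  ...     | k , ½^k<ε = disjoint {fromℚ (left s)}
    (λ _ → 0≤left s , ℚ.≤-trans (left≤right s) (right≤1 s))
    (left∈A s)
    (close⇒B (k , λ n k≤n → ℚ.≤-trans
      (dist (within k n k≤n) (ℚ.≤-refl , left≤right s)) (ℚ.<⇒≤ ½^k<ε)))
    where s = stage k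

-- Opaque, since unfolding would make conversion compare the Cauchy moduli of x + c (y - x).
opaque
  lerp : ℝ → ℝ → ℝ → ℝ
  lerp x y c = x + c * (y + fromℚ (ℚ.- 1ℚ) * x)

  seq-lerp : ∀ x y c n → seq (lerp x y c) n ≡ seq x n ℚ.+ seq c n ℚ.* (seq y n ℚ.- seq x n)
  seq-lerp x y c n = identity (seq x n) (seq y n) (seq c n)
    where
    identity : ∀ p q c → p ℚ.+ c ℚ.* (q ℚ.+ ℚ.- 1ℚ ℚ.* p) ≡ p ℚ.+ c ℚ.* (q ℚ.- p)
    identity = solve 3 (λ p q c → p :+ c :* (q :+ con (ℚ.- 1ℚ) :* p) := p :+ c :* (q :- p)) refl

seq-lerp-0 : ∀ x y n → seq x n ≡ seq (lerp x y (fromℚ 0ℚ)) n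
seq-lerp-0 x y n = trans (identity (seq x n) (seq y n)) (sym (seq-lerp x y (fromℚ 0ℚ) n))
  where
  identity : ∀ p q → p ≡ p ℚ.+ 0ℚ ℚ.* (q ℚ.- p)
  identity = solve 2 (λ p q → p := p :+ con 0ℚ :* (q :- p)) refl

seq-lerp-1 : ∀ x y n → seq y n ≡ seq (lerp x y (fromℚ 1ℚ)) n
seq-lerp-1 x y n = trans (identity (seq x n) (seq y n)) (sym (seq-lerp x y (fromℚ 1ℚ) n))
  where
  identity : ∀ p q → q ≡ p ℚ.+ 1ℚ ℚ.* (q ℚ.- p)
  identity = solve 2 (λ p q → q := p :+ con 1ℚ :* (q :- p)) refl

affine-lipschitz : ∀ {B η} p v c d → 0ℚ ℚ.≤ B → ∣ v ∣ ℚ.≤ B → ∣ c ℚ.- d ∣ ℚ.≤ η →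
                   ∣ (p ℚ.+ c ℚ.* v) ℚ.- (p ℚ.+ d ℚ.* v) ∣ ℚ.≤ B ℚ.* η
affine-lipschitz {B} {η} p v c d B≥0 v≤B c-d≤η = begin
  ∣ (p ℚ.+ c ℚ.* v) ℚ.- (p ℚ.+ d ℚ.* v) ∣ ≡⟨ cong ∣_∣ (factor p v c d) ⟩
  ∣ v ℚ.* (c ℚ.- d) ∣                     ≡⟨ ℚ.∣p*q∣≡∣p∣*∣q∣ v (c ℚ.- d) ⟩
  ∣ v ∣ ℚ.* ∣ c ℚ.- d ∣                   ≤⟨ ℚ.*-monoʳ-≤-nonNeg _ {{ℚ.∣-∣-nonNeg (c ℚ.- d)}} v≤B ⟩
  B ℚ.* ∣ c ℚ.- d ∣                       ≤⟨ ℚ.*-monoˡ-≤-nonNeg B {{nonNegative B≥0}} c-d≤η ⟩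
  B ℚ.* η                                 ∎
  where
  open ℚ.≤-Reasoning
  factor : ∀ p v c d → (p ℚ.+ c ℚ.* v) ℚ.- (p ℚ.+ d ℚ.* v) ≡ v ℚ.* (c ℚ.- d)
  factor = solve 4 (λ p v c d → (p :+ c :* v) :- (p :+ d :* v) := v :* (c :- d)) refl

-- The segment is Lipschitz in its parameter, with an eventual bound of `y - x` as constant.
-- Allowing every `ζ ≤ η` lets two coordinates share the smaller modulus, and `½ ℚ.* ε` leaves room
-- for an open box of radius `ε`.
lerp-close : ∀ x y {ε} → 0ℚ ℚ.< ε → ∃[ η ] (0ℚ ℚ.< η ×
             (∀ {ζ c d} → ζ ℚ.≤ η → Close ζ c d → Close (½ ℚ.* ε) (lerp x y c) (lerp x y d)))
lerp-close x y {ε} ε>0 = η , proj₁ (proj₂ small) , λ {ζ} {c} {d} → close {ζ} {c} {d}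
  where
  slope : ℝ
  slope = y + fromℚ (ℚ.- 1ℚ) * x
  bound = eventually-bounded slope
  B     = proj₁ bound
  B>0   = proj₁ (proj₂ bound)
  small = shrink B ε B>0 ε>0
  η     = proj₁ small
  seq-slope : ∀ n → seq slope n ≡ seq y n ℚ.- seq x n
  seq-slope n = solve 2 (λ p q → q :+ con (ℚ.- 1ℚ) :* p := q :- p) refl (seq x n) (seq y n)
  close : ∀ {ζ c d} → ζ ℚ.≤ η → Close ζ c d → Close (½ ℚ.* ε) (lerp x y c) (lerp x y d)
  close {ζ} {c} {d} ζ≤η c≈d = mapᵉ
    {P = λ n → ∣ seq slope n ∣ ℚ.≤ B × ∣ seq c n ℚ.- seq d n ∣ ℚ.≤ ζ}
    (λ n (≤B , ≤ζ) → subst₂ ℚ._≤_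
      (cong ∣_∣ (sym (cong₂ ℚ._-_ (seq-lerp x y c n) (seq-lerp x y d n)))) (proj₂ (proj₂ small))
      (affine-lipschitz (seq x n) (seq y n ℚ.- seq x n) (seq c n) (seq d n) (ℚ.<⇒≤ B>0)
        (subst (λ v → ∣ v ∣ ℚ.≤ B) (seq-slope n) ≤B) (ℚ.≤-trans ≤ζ ζ≤η)))
    (proj₂ (proj₂ bound) ∩ᵉ c≈d)

0<p⊓q : ∀ {p q} → 0ℚ ℚ.< p → 0ℚ ℚ.< q → 0ℚ ℚ.< p ℚ.⊓ q
0<p⊓q {p} {q} p>0 q>0 with ℚ.⊓-sel p q
... | inj₁ eq = subst (0ℚ ℚ.<_) (sym eq) p>0
... | inj₂ eq = subst (0ℚ ℚ.<_) (sym eq) q>0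

segment⁻¹-open : ∀ {U} u₁ u₂ v₁ v₂ → Open U → Open₁ (λ c → (lerp u₁ v₁ c , lerp u₂ v₂ c) ∈ U)
segment⁻¹-open {U} u₁ u₂ v₁ v₂ openU {c} c∈ = preimage (openU c∈)
  where
  preimage : ∃[ ε ] (0ℚ ℚ.< ε × Box (lerp u₁ v₁ c , lerp u₂ v₂ c) ε ⊆ U) →
             ∃[ η ] (0ℚ ℚ.< η × (∀ {d} → Close η c d → (lerp u₁ v₁ d , lerp u₂ v₂ d) ∈ U))
  preimage (ε , ε>0 , box⊆U) =
    let (η₁ , η₁>0 , close₁) = lerp-close u₁ v₁ ε>0
        (η₂ , η₂>0 , close₂) = lerp-close u₂ v₂ ε>0
    in η₁ ℚ.⊓ η₂ , 0<p⊓q η₁>0 η₂>0 , λ {d} close → box⊆U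
      (close-box {½ ℚ.* ε} {ε} {lerp u₁ v₁ c} {lerp u₂ v₂ c} {lerp u₁ v₁ d} {lerp u₂ v₂ d} (½*ε<ε ε>0)
        (close₁ {η₁ ℚ.⊓ η₂} {c} {d} (ℚ.p⊓q≤p η₁ η₂) close)
        (close₂ {η₁ ℚ.⊓ η₂} {c} {d} (ℚ.p⊓q≤q η₁ η₂) close))

Convex : Pred ℝ² 0ℓ → Set
Convex S = ∀ {u₁ u₂ v₁ v₂ c} → (u₁ , u₂) ∈ S → (v₁ , v₂) ∈ S → c ∈ UnitInterval →
           (lerp u₁ v₁ c , lerp u₂ v₂ c) ∈ S

-- A separation of `S` pulls back along a segment from a point in `U` to a point in `V`, where
-- bisection refutes it.
convex⇒connected : ∀ {S} → Convex S → Connected S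
convex⇒connected {S} convex U V
  (openU , openV , cover , ((u₁ , u₂) , u∈S , u∈U) , ((v₁ , v₂) , v∈S , v∈V) , disjoint) =
  Bisection.absurd
    (λ {c} → segment⁻¹-open {U} u₁ u₂ v₁ v₂ openU {c})
    (λ {c} → segment⁻¹-open {V} u₁ u₂ v₁ v₂ openV {c})
    (λ {c} c∈I → cover (convex {c = c} u∈S v∈S c∈I))
    (λ {c} c∈I c∈U c∈V → disjoint _ (convex {c = c} u∈S v∈S c∈I , c∈U , c∈V))
    -- The ends of the segment agree with the two given points only termwise.
    (open-resp {U} {u₁} {u₂} {lerp u₁ v₁ (fromℚ 0ℚ)} {lerp u₂ v₂ (fromℚ 0ℚ)} openU
      (seq-lerp-0 u₁ v₁) (seq-lerp-0 u₂ v₂) u∈U)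
    (open-resp {V} {v₁} {v₂} {lerp u₁ v₁ (fromℚ 1ℚ)} {lerp u₂ v₂ (fromℚ 1ℚ)} openV
      (seq-lerp-1 u₁ v₁) (seq-lerp-1 u₂ v₂) v∈V)

-- Signs of reals and cells of the arrangement

unit : Sign → ℚ
unit Sign.+ = 1ℚ
unit Sign.- = ℚ.- 1ℚ

-- Keeping the sign as a parameter treats both open half-planes of a line in one proof. The margin
-- is what makes the condition stable under perturbation.
record HasSign (s : Sign) (x : ℝ) : Set where
  constructor margin
  field
    δ     : ℚ
    δ>0   : 0ℚ ℚ.< δ
    bound : Eventually (λ n → δ ℚ.≤ unit s ℚ.* seq x n)

#⇒HasSign : ∀ {x} (h : x # fromℕ 0) → HasSign (sgn h) x
#⇒HasSign {x} (inj₁ (gap δ δ>0 N h)) = margin δ δ>0 (N , λ n N≤n →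
  ≤-witness _ (p≤q⇒0≤q-p (h n N≤n)) (identity δ (seq x n)))
  where
  identity : ∀ δ x → ℚ.- 1ℚ ℚ.* x ≡ δ ℚ.+ (0ℚ ℚ.- (x ℚ.+ δ))
  identity = solve 2 (λ δ x → con (ℚ.- 1ℚ) :* x := δ :+ (con 0ℚ :- (x :+ δ))) refl
#⇒HasSign {x} (inj₂ (gap δ δ>0 N h)) = margin δ δ>0 (N , λ n N≤n →
  subst₂ ℚ._≤_ (ℚ.+-identityˡ δ) (sym (ℚ.*-identityˡ (seq x n))) (h n N≤n))

HasSign⇒# : ∀ {s x} → HasSign s x → x # fromℕ 0
HasSign⇒# {Sign.-} {x} (margin δ δ>0 (N , h)) = inj₁ (gap δ δ>0 N λ n N≤n →
  ≤-witness _ (p≤q⇒0≤q-p (h n N≤n)) (identity δ (seq x n)))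
  where
  identity : ∀ δ x → 0ℚ ≡ (x ℚ.+ δ) ℚ.+ (ℚ.- 1ℚ ℚ.* x ℚ.- δ)
  identity = solve 2 (λ δ x → con 0ℚ := (x :+ δ) :+ (con (ℚ.- 1ℚ) :* x :- δ)) refl
HasSign⇒# {Sign.+} {x} (margin δ δ>0 (N , h)) = inj₂ (gap δ δ>0 N λ n N≤n →
  subst₂ ℚ._≤_ (sym (ℚ.+-identityˡ δ)) (ℚ.*-identityˡ (seq x n)) (h n N≤n))

HasSign-asym : ∀ {x} → HasSign Sign.+ x → HasSign Sign.- x → ⊥
HasSign-asym {x} (margin δ δ>0 (M , p)) (margin η η>0 (N , q)) =
  ℚ.<-irrefl refl (begin-strict
    0ℚ                                       <⟨ ℚ.+-mono-< δ>0 η>0 ⟩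
    δ ℚ.+ η                                  ≤⟨ ℚ.+-mono-≤ (p K (ℕ.m≤m⊔n M N)) (q K (ℕ.m≤n⊔m M N)) ⟩
    1ℚ ℚ.* seq x K ℚ.+ ℚ.- 1ℚ ℚ.* seq x K    ≡⟨ cancel (seq x K) ⟩
    0ℚ                                       ∎)
  where
  open ℚ.≤-Reasoning
  K = M ℕ.⊔ N
  cancel : ∀ x → 1ℚ ℚ.* x ℚ.+ ℚ.- 1ℚ ℚ.* x ≡ 0ℚ
  cancel = solve 1 (λ x → con 1ℚ :* x :+ con (ℚ.- 1ℚ) :* x := con 0ℚ) refl

HasSign-unique : ∀ {s s′ x} → HasSign s x → HasSign s′ x → s ≡ s′
HasSign-unique {Sign.+} {Sign.+} _ _ = refl
HasSign-unique {Sign.-} {Sign.-} _ _ = refl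
HasSign-unique {Sign.+} {Sign.-} p q = contradiction q (HasSign-asym p)
HasSign-unique {Sign.-} {Sign.+} p q = contradiction p (HasSign-asym q)

<+⇒≤ : ∀ {x y ε} → x < y + fromℚ ε → Eventually (λ n → seq x n ℚ.- seq y n ℚ.≤ ε)
<+⇒≤ {x} {y} {ε} (gap δ δ>0 N h) = N , λ n N≤n →
  ≤-witness _ (ℚ.+-mono-≤ (p≤q⇒0≤q-p (h n N≤n)) (ℚ.<⇒≤ δ>0)) (identity (seq x n) (seq y n) ε δ)
  where
  identity : ∀ x y ε δ → ε ≡ (x ℚ.- y) ℚ.+ ((y ℚ.+ ε ℚ.- (x ℚ.+ δ)) ℚ.+ δ)
  identity = solve 4 (λ x y ε δ → ε := (x :- y) :+ ((y :+ ε :- (x :+ δ)) :+ δ)) refl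

signed-diff≤ : ∀ s {x y ε} → x < y + fromℚ ε → y < x + fromℚ ε →
               Eventually (λ n → unit s ℚ.* (seq x n ℚ.- seq y n) ℚ.≤ ε)
signed-diff≤ Sign.+ {x} {y} {ε} x<y+ε _ = mapᵉ
  (λ n → subst (ℚ._≤ ε) (sym (ℚ.*-identityˡ (seq x n ℚ.- seq y n)))) (<+⇒≤ {x} {y} x<y+ε)
signed-diff≤ Sign.- {x} {y} {ε} _ y<x+ε = mapᵉ
  (λ n → subst (ℚ._≤ ε) (identity (seq x n) (seq y n))) (<+⇒≤ {y} {x} y<x+ε)
  where
  identity : ∀ x y → y ℚ.- x ≡ ℚ.- 1ℚ ℚ.* (x ℚ.- y)
  identity = solve 2 (λ x y → y :- x := con (ℚ.- 1ℚ) :* (x :- y)) refl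

-- As `A` and `B` are nonnegative, the two signed displacements lower the signed value by at most
-- `A * ε + B * ε`. Here `u` is meant to be `unit s` and `o` the constant term of `ℓ i`.
perturbation-≥ : ∀ {δ ε} u o A B x₁ x₂ y₁ y₂ → 0ℚ ℚ.≤ A → 0ℚ ℚ.≤ B →
                 δ ℚ.≤ u ℚ.* (o ℚ.+ A ℚ.* x₁ ℚ.+ B ℚ.* x₂) →
                 u ℚ.* (x₁ ℚ.- y₁) ℚ.≤ ε → u ℚ.* (x₂ ℚ.- y₂) ℚ.≤ ε →
                 δ ℚ.- (A ℚ.+ B) ℚ.* ε ℚ.≤ u ℚ.* (o ℚ.+ A ℚ.* y₁ ℚ.+ B ℚ.* y₂)
perturbation-≥ {δ} {ε} u o A B x₁ x₂ y₁ y₂ 0≤A 0≤B x≥δ ≤ε₁ ≤ε₂ = ≤-witness _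
  (ℚ.+-mono-≤ (p≤q⇒0≤q-p x≥δ)
    (ℚ.+-mono-≤ (0≤p*q 0≤A (p≤q⇒0≤q-p ≤ε₁)) (0≤p*q 0≤B (p≤q⇒0≤q-p ≤ε₂))))
  (identity u o A B x₁ x₂ y₁ y₂ ε δ)
  where
  identity : ∀ u o A B x₁ x₂ y₁ y₂ ε δ → u ℚ.* (o ℚ.+ A ℚ.* y₁ ℚ.+ B ℚ.* y₂) ≡
    (δ ℚ.- (A ℚ.+ B) ℚ.* ε) ℚ.+ ((u ℚ.* (o ℚ.+ A ℚ.* x₁ ℚ.+ B ℚ.* x₂) ℚ.- δ) ℚ.+
      (A ℚ.* (ε ℚ.- u ℚ.* (x₁ ℚ.- y₁)) ℚ.+ B ℚ.* (ε ℚ.- u ℚ.* (x₂ ℚ.- y₂))))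
  identity = solve 10 (λ u o A B x₁ x₂ y₁ y₂ ε δ → u :* (o :+ A :* y₁ :+ B :* y₂) :=
    (δ :- (A :+ B) :* ε) :+ ((u :* (o :+ A :* x₁ :+ B :* x₂) :- δ) :+
      (A :* (ε :- u :* (x₁ :- y₁)) :+ B :* (ε :- u :* (x₂ :- y₂))))) refl

HasSign-ℓ-box : ∀ s i {δ ε x₁ x₂ y₁ y₂} → 0ℚ ℚ.< δ → (ℕ⇒ℚ i ℚ.+ ℕ⇒ℚ (i ℕ.^ 2)) ℚ.* ε ≡ ½ ℚ.* δ →
                Eventually (λ n → δ ℚ.≤ unit s ℚ.* seq (ℓ i (x₁ , x₂)) n) →
                Box (x₁ , x₂) ε (y₁ , y₂) → HasSign s (ℓ i (y₁ , y₂))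
HasSign-ℓ-box s i {δ} {ε} {x₁} {x₂} {y₁} {y₂} δ>0 [A+B]ε≡½δ x-bound ((p₁ , q₁) , (p₂ , q₂)) =
  margin (½ ℚ.* δ) (0<p*q 0<½ δ>0) (mapᵉ
    {P = λ n → δ ℚ.≤ unit s ℚ.* (ℕ⇒ℚ 1 ℚ.+ A ℚ.* seq x₁ n ℚ.+ B ℚ.* seq x₂ n)
             × unit s ℚ.* (seq x₁ n ℚ.- seq y₁ n) ℚ.≤ ε
             × unit s ℚ.* (seq x₂ n ℚ.- seq y₂ n) ℚ.≤ ε}
    (λ n (x≥δ , ≤ε₁ , ≤ε₂) →
      subst (ℚ._≤ unit s ℚ.* (ℕ⇒ℚ 1 ℚ.+ A ℚ.* seq y₁ n ℚ.+ B ℚ.* seq y₂ n)) remainder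
        (perturbation-≥ (unit s) (ℕ⇒ℚ 1) A B (seq x₁ n) (seq x₂ n) (seq y₁ n) (seq y₂ n)
          (0≤ℕ⇒ℚ i) (0≤ℕ⇒ℚ (i ℕ.^ 2)) x≥δ ≤ε₁ ≤ε₂))
    (x-bound ∩ᵉ signed-diff≤ s {x₁} {y₁} p₁ q₁ ∩ᵉ signed-diff≤ s {x₂} {y₂} p₂ q₂))
  where
  A = ℕ⇒ℚ i
  B = ℕ⇒ℚ (i ℕ.^ 2)
  δ-½δ : ∀ δ → δ ℚ.- ½ ℚ.* δ ≡ ½ ℚ.* δ
  δ-½δ = solve 1 (λ δ → δ :- con ½ :* δ := con ½ :* δ) refl
  remainder : δ ℚ.- (A ℚ.+ B) ℚ.* ε ≡ ½ ℚ.* δ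
  remainder = trans (cong (λ q → δ ℚ.- q) [A+B]ε≡½δ) (δ-½δ δ)

HasSign-ℓ-open : ∀ s i .{{_ : NonZero i}} → Open (λ z → HasSign s (ℓ i z))
HasSign-ℓ-open s i {x₁ , x₂} (margin δ δ>0 x-bound) = radius
  -- The radius is half the margin divided by `i + i²`, so half the margin survives in the box.
  (shrink (ℕ⇒ℚ i ℚ.+ ℕ⇒ℚ (i ℕ.^ 2)) δ (ℚ.+-mono-<-≤ (ℕ⇒ℚ-pos i) (0≤ℕ⇒ℚ (i ℕ.^ 2))) δ>0)
  where
  radius : ∃[ ε ] (0ℚ ℚ.< ε × (ℕ⇒ℚ i ℚ.+ ℕ⇒ℚ (i ℕ.^ 2)) ℚ.* ε ≡ ½ ℚ.* δ) →
           ∃[ ε ] (0ℚ ℚ.< ε × Box (x₁ , x₂) ε ⊆ (λ z → HasSign s (ℓ i z)))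
  radius (ε , ε>0 , eq) = ε , ε>0 , λ {y} y∈Box →
    HasSign-ℓ-box s i {δ} {ε} {x₁} {x₂} {proj₁ y} {proj₂ y} δ>0 eq x-bound y∈Box

affine-combination-≥ : ∀ {δ p q c} → 0ℚ ℚ.≤ c → c ℚ.≤ 1ℚ → δ ℚ.≤ p → δ ℚ.≤ q →
                       δ ℚ.≤ p ℚ.+ c ℚ.* (q ℚ.- p)
affine-combination-≥ {δ} {p} {q} {c} 0≤c c≤1 δ≤p δ≤q = ≤-witness _
  (ℚ.+-mono-≤ (0≤p*q (p≤q⇒0≤q-p c≤1) (p≤q⇒0≤q-p δ≤p)) (0≤p*q 0≤c (p≤q⇒0≤q-p δ≤q)))
  (solve 4 (λ δ p q c → p :+ c :* (q :- p) := δ :+ ((con 1ℚ :- c) :* (p :- δ) :+ c :* (q :- δ)))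
    refl δ p q c)

HasSign-ℓ-convex : ∀ s i → Convex (λ z → HasSign s (ℓ i z))
HasSign-ℓ-convex s i {u₁} {u₂} {v₁} {v₂} {c} (margin δ δ>0 u-bound) (margin η η>0 v-bound) c∈I =
  -- The smaller margin holds at both ends, hence at every convex combination of them.
  margin (δ ℚ.⊓ η) (0<p⊓q δ>0 η>0) (mapᵉ
    {P = λ n → δ ℚ.≤ unit s ℚ.* seq (ℓ i (u₁ , u₂)) n × η ℚ.≤ unit s ℚ.* seq (ℓ i (v₁ , v₂)) n}
    (λ n (u≥δ , v≥η) → subst (δ ℚ.⊓ η ℚ.≤_) (sym (value n))
      (affine-combination-≥ (proj₁ (c∈I n)) (proj₂ (c∈I n))
        (ℚ.≤-trans (ℚ.p⊓q≤p δ η) u≥δ) (ℚ.≤-trans (ℚ.p⊓q≤q δ η) v≥η)))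
    (u-bound ∩ᵉ v-bound))
  where
  A = ℕ⇒ℚ i
  B = ℕ⇒ℚ (i ℕ.^ 2)
  identity : ∀ u o A B u₁ u₂ v₁ v₂ c →
    u ℚ.* (o ℚ.+ A ℚ.* (u₁ ℚ.+ c ℚ.* (v₁ ℚ.- u₁)) ℚ.+ B ℚ.* (u₂ ℚ.+ c ℚ.* (v₂ ℚ.- u₂))) ≡
    u ℚ.* (o ℚ.+ A ℚ.* u₁ ℚ.+ B ℚ.* u₂) ℚ.+
      c ℚ.* (u ℚ.* (o ℚ.+ A ℚ.* v₁ ℚ.+ B ℚ.* v₂) ℚ.- u ℚ.* (o ℚ.+ A ℚ.* u₁ ℚ.+ B ℚ.* u₂))
  identity = solve 9 (λ u o A B u₁ u₂ v₁ v₂ c →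
    u :* (o :+ A :* (u₁ :+ c :* (v₁ :- u₁)) :+ B :* (u₂ :+ c :* (v₂ :- u₂))) :=
    u :* (o :+ A :* u₁ :+ B :* u₂) :+
      c :* (u :* (o :+ A :* v₁ :+ B :* v₂) :- u :* (o :+ A :* u₁ :+ B :* u₂))) refl
  value : ∀ n → unit s ℚ.* seq (ℓ i (lerp u₁ v₁ c , lerp u₂ v₂ c)) n ≡
    unit s ℚ.* seq (ℓ i (u₁ , u₂)) n ℚ.+
      seq c n ℚ.* (unit s ℚ.* seq (ℓ i (v₁ , v₂)) n ℚ.- unit s ℚ.* seq (ℓ i (u₁ , u₂)) n)
  value n = trans
    (cong₂ (λ p q → unit s ℚ.* (ℕ⇒ℚ 1 ℚ.+ A ℚ.* p ℚ.+ B ℚ.* q)) (seq-lerp u₁ v₁ c n) (seq-lerp u₂ v₂ c n))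
    (identity (unit s) (ℕ⇒ℚ 1) A B (seq u₁ n) (seq u₂ n) (seq v₁ n) (seq v₂ n) (seq c n))

sign-at : ∀ {n} (x : Point n) j → HasSign (sgn (off x j)) (ℓ (suc (toℕ j)) (coords x))
sign-at x j = #⇒HasSign {ℓ (suc (toℕ j)) (coords x)} (off x j)

HasSign-dec : ∀ {x} → x # fromℕ 0 → HasSign Sign.+ x ⊎ HasSign Sign.- x
HasSign-dec {x} x#0 = by-sign (sgn x#0) (#⇒HasSign {x} x#0)
  where
  by-sign : ∀ s → HasSign s x → HasSign Sign.+ x ⊎ HasSign Sign.- x
  by-sign Sign.+ = inj₁
  by-sign Sign.- = inj₂

connected-same-side : ∀ {S z w} i .{{_ : NonZero i}} → Connected S → (∀ {p} → p ∈ S → ℓ i p # fromℕ 0) →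
                      z ∈ S → w ∈ S → HasSign Sign.+ (ℓ i z) → HasSign Sign.- (ℓ i w) → ⊥
connected-same-side {S} {z} {w} i connected S⊆ z∈S w∈S z+ w- =
  connected (λ p → HasSign Sign.+ (ℓ i p)) (λ p → HasSign Sign.- (ℓ i p))
    ( (λ {p} → HasSign-ℓ-open Sign.+ i {p}) , (λ {p} → HasSign-ℓ-open Sign.- i {p})
    , (λ {p} p∈S → HasSign-dec {ℓ i p} (S⊆ p∈S))
    , (z , z∈S , z+) , (w , w∈S , w-) , λ p (_ , p+ , p-) → HasSign-asym {ℓ i p} p+ p-)

-- The signs are variables here so that they can be split on; equality of signs is then reached
-- through the one impossible configuration.
connected-same-sign : ∀ {S z w} s s′ i .{{_ : NonZero i}} → Connected S → (∀ {p} → p ∈ S → ℓ i p # fromℕ 0) →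
                      z ∈ S → w ∈ S → HasSign s (ℓ i z) → HasSign s′ (ℓ i w) → s ≡ s′
connected-same-sign Sign.+ Sign.+ i connected S⊆ z∈S w∈S _ _ = refl
connected-same-sign Sign.- Sign.- i connected S⊆ z∈S w∈S _ _ = refl
connected-same-sign {S} {z} {w} Sign.+ Sign.- i connected S⊆ z∈S w∈S z+ w- =
  ⊥-elim (connected-same-side {S} {z} {w} i connected S⊆ z∈S w∈S z+ w-)
connected-same-sign {S} {z} {w} Sign.- Sign.+ i connected S⊆ z∈S w∈S z- w+ =
  ⊥-elim (connected-same-side {S} {w} {z} i connected S⊆ w∈S z∈S w+ z-)

connected⇒sgn≡ : ∀ {n} {x y : Point n} → SameComponent x y → ∀ j → sgn (off x j) ≡ sgn (off y j)
connected⇒sgn≡ {n} {x} {y} (S , connected , S⊆ , x∈S , y∈S) j =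
  connected-same-sign {S} {coords x} {coords y} (sgn (off x j)) (sgn (off y j)) (suc (toℕ j))
    connected (λ {p} p∈S → S⊆ {p} p∈S j) x∈S y∈S (sign-at x j) (sign-at y j)

Cell : ∀ {n} → (Fin n → Sign) → Pred ℝ² 0ℓ
Cell s z = ∀ j → HasSign (s j) (ℓ (suc (toℕ j)) z)

Cell-convex : ∀ {n} (s : Fin n → Sign) → Convex (Cell s)
Cell-convex s {u₁} {u₂} {v₁} {v₂} {c} u∈ v∈ c∈I j =
  HasSign-ℓ-convex (s j) (suc (toℕ j)) {u₁} {u₂} {v₁} {v₂} {c} (u∈ j) (v∈ j) c∈I

sgn≡⇒connected : ∀ {n} {x y : Point n} → (∀ j → sgn (off x j) ≡ sgn (off y j)) → SameComponent x y
sgn≡⇒connected {n} {x} {y} same =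
  Cell s , convex⇒connected {Cell s} (λ {u₁} {u₂} {v₁} {v₂} {c} → Cell-convex s {u₁} {u₂} {v₁} {v₂} {c})
  , (λ {z} z∈ j → HasSign⇒# {s j} {ℓ (suc (toℕ j)) z} (z∈ j)) , sign-at x
  , λ j → subst (λ s → HasSign s (ℓ (suc (toℕ j)) (coords y))) (sym (same j)) (sign-at y j)
  where
  s : Fin n → Sign
  s j = sgn (off x j)

-- A point in each cell

-- The sign of `t + ½ - i` at `i = j + 1`; the shift by ½ keeps the root off the integers.
step : ℕ → ℕ → Sign
step zero    j       = Sign.-
step (suc t) zero    = Sign.+
step (suc t) (suc j) = step t j

ℕ⇒ℚ-suc : ∀ n → ℕ⇒ℚ (suc n) ≡ 1ℚ ℚ.+ ℕ⇒ℚ n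
ℕ⇒ℚ-suc = ℕ⇒ℚ-+ 1

0<ℕ⇒ℚ+½ : ∀ n → 0ℚ ℚ.< ℕ⇒ℚ n ℚ.+ ½
0<ℕ⇒ℚ+½ n = ℚ.+-mono-≤-< (0≤ℕ⇒ℚ n) 0<½

step-sign : ∀ t j → 0ℚ ℚ.< unit (step t j) ℚ.* (ℕ⇒ℚ t ℚ.+ ½ ℚ.- ℕ⇒ℚ (suc j))
step-sign zero j = subst (0ℚ ℚ.<_)
  (trans (identity (ℕ⇒ℚ j)) (cong (λ q → ℚ.- 1ℚ ℚ.* (ℕ⇒ℚ 0 ℚ.+ ½ ℚ.- q)) (sym (ℕ⇒ℚ-suc j))))
  (0<ℕ⇒ℚ+½ j)
  where
  identity : ∀ q → q ℚ.+ ½ ≡ ℚ.- 1ℚ ℚ.* (0ℚ ℚ.+ ½ ℚ.- (1ℚ ℚ.+ q))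
  identity = solve 1 (λ q → q :+ con ½ := con (ℚ.- 1ℚ) :* (con 0ℚ :+ con ½ :- (con 1ℚ :+ q))) refl
step-sign (suc t) zero = subst (0ℚ ℚ.<_)
  (trans (identity (ℕ⇒ℚ t)) (cong (λ q → 1ℚ ℚ.* (q ℚ.+ ½ ℚ.- ℕ⇒ℚ 1)) (sym (ℕ⇒ℚ-suc t))))
  (0<ℕ⇒ℚ+½ t)
  where
  identity : ∀ q → q ℚ.+ ½ ≡ 1ℚ ℚ.* (1ℚ ℚ.+ q ℚ.+ ½ ℚ.- 1ℚ)
  identity = solve 1 (λ q → q :+ con ½ := con 1ℚ :* (con 1ℚ :+ q :+ con ½ :- con 1ℚ)) refl
step-sign (suc t) (suc j) = subst (0ℚ ℚ.<_)
  (trans (identity (unit (step t j)) (ℕ⇒ℚ t) (ℕ⇒ℚ (suc j)))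
    (cong₂ (λ p q → unit (step t j) ℚ.* (p ℚ.+ ½ ℚ.- q)) (sym (ℕ⇒ℚ-suc t)) (sym (ℕ⇒ℚ-suc (suc j)))))
  (step-sign t j)
  where
  identity : ∀ u p q → u ℚ.* (p ℚ.+ ½ ℚ.- q) ≡ u ℚ.* (1ℚ ℚ.+ p ℚ.+ ½ ℚ.- (1ℚ ℚ.+ q))
  identity = solve 3 (λ u p q →
    u :* (p :+ con ½ :- q) := u :* (con 1ℚ :+ p :+ con ½ :- (con 1ℚ :+ q))) refl

-- Multiplying `t + ½ - i` by the positive `a = 1 / (t + ½)` normalises it to the value 1 at `i = 0`
-- without changing its sign.
step-sign-reciprocal : ∀ t j {a} → 0ℚ ℚ.< a → (ℕ⇒ℚ t ℚ.+ ½) ℚ.* a ≡ 1ℚ →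
                       0ℚ ℚ.< unit (step t j) ℚ.* (1ℚ ℚ.- ℕ⇒ℚ (suc j) ℚ.* a)
step-sign-reciprocal t j {a} a>0 αa≡1 = subst (0ℚ ℚ.<_)
  (trans (identity (unit (step t j)) (ℕ⇒ℚ t ℚ.+ ½) (ℕ⇒ℚ (suc j)) a)
    (cong (λ q → unit (step t j) ℚ.* (q ℚ.- ℕ⇒ℚ (suc j) ℚ.* a)) αa≡1))
  (0<p*q (step-sign t j) a>0)
  where
  identity : ∀ u α i a → u ℚ.* (α ℚ.- i) ℚ.* a ≡ u ℚ.* (α ℚ.* a ℚ.- i ℚ.* a)
  identity = solve 4 (λ u α i a → u :* (α :- i) :* a := u :* (α :* a :- i :* a)) refl

unit-* : ∀ s s′ → unit (s Sign.* s′) ≡ unit s ℚ.* unit s′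
unit-* Sign.+ Sign.+ = refl
unit-* Sign.+ Sign.- = refl
unit-* Sign.- Sign.+ = refl
unit-* Sign.- Sign.- = refl

-- Expanding `(1 - i a) (1 - i b)` gives `1 - i (a + b) + i² a b`, whence the coordinates of the
-- point.
HasSign-from-roots : ∀ s s′ i a b → 0ℚ ℚ.< unit s ℚ.* (1ℚ ℚ.- ℕ⇒ℚ i ℚ.* a) →
                     0ℚ ℚ.< unit s′ ℚ.* (1ℚ ℚ.- ℕ⇒ℚ i ℚ.* b) →
                     HasSign (s Sign.* s′) (ℓ i (fromℚ (ℚ.- (a ℚ.+ b)) , fromℚ (a ℚ.* b)))
-- The sequences are constant, so the signed value is its own margin from index 0 on.
HasSign-from-roots s s′ i a b p q = margin _ (0<p*q p q) (0 , λ n _ → ℚ.≤-reflexive (value n))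
  where
  identity : ∀ u u′ i a b → u ℚ.* (1ℚ ℚ.- i ℚ.* a) ℚ.* (u′ ℚ.* (1ℚ ℚ.- i ℚ.* b)) ≡
    u ℚ.* u′ ℚ.* quadratic i (ℚ.- (a ℚ.+ b)) (a ℚ.* b)
  identity = solve 5 (λ u u′ i a b → u :* (con 1ℚ :- i :* a) :* (u′ :* (con 1ℚ :- i :* b)) :=
    u :* u′ :* (con 1ℚ :+ i :* (:- (a :+ b)) :+ i :* i :* (a :* b))) refl
  value : ∀ n → unit s ℚ.* (1ℚ ℚ.- ℕ⇒ℚ i ℚ.* a) ℚ.* (unit s′ ℚ.* (1ℚ ℚ.- ℕ⇒ℚ i ℚ.* b)) ≡
    unit (s Sign.* s′) ℚ.* seq (ℓ i (fromℚ (ℚ.- (a ℚ.+ b)) , fromℚ (a ℚ.* b))) n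
  value n = trans (identity (unit s) (unit s′) (ℕ⇒ℚ i) a b)
    (cong₂ ℚ._*_ (sym (unit-* s s′)) (sym (seq-ℓ i (fromℚ (ℚ.- (a ℚ.+ b))) (fromℚ (a ℚ.* b)) n)))

-- The sign of a product of two linear factors, with roots `t + ½` and `t + r + ½`: both factors are
-- positive before the block, one is negative in it and both are negative after it.
block-sign : ∀ {n} → ℕ → ℕ → Fin n → Sign
block-sign t r j = step t (toℕ j) Sign.* step (t ℕ.+ r) (toℕ j)

-- The quadratic with roots t + ½ and t + r + ½, normalised to the value 1 at 0.
block-cell-nonempty : ∀ {n} t r → ∃[ z ] z ∈ Cell {n} (block-sign t r)
block-cell-nonempty {n} t r = from-roots
  (reciprocal (ℕ⇒ℚ t ℚ.+ ½) (0<ℕ⇒ℚ+½ t)) (reciprocal (ℕ⇒ℚ (t ℕ.+ r) ℚ.+ ½) (0<ℕ⇒ℚ+½ (t ℕ.+ r)))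
  where
  from-roots : ∃[ a ] (0ℚ ℚ.< a × (ℕ⇒ℚ t ℚ.+ ½) ℚ.* a ≡ 1ℚ) →
               ∃[ b ] (0ℚ ℚ.< b × (ℕ⇒ℚ (t ℕ.+ r) ℚ.+ ½) ℚ.* b ≡ 1ℚ) →
               ∃[ z ] z ∈ Cell {n} (block-sign t r)
  from-roots (a , a>0 , αa≡1) (b , b>0 , βb≡1) =
    (fromℚ (ℚ.- (a ℚ.+ b)) , fromℚ (a ℚ.* b)) , λ j →
      HasSign-from-roots (step t (toℕ j)) (step (t ℕ.+ r) (toℕ j)) (suc (toℕ j)) a b
        (step-sign-reciprocal t (toℕ j) a>0 αa≡1) (step-sign-reciprocal (t ℕ.+ r) (toℕ j) b>0 βb≡1)

-- `sgn` reads the apartness proof rebuilt by `HasSign⇒#`, so its value is identified through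
-- uniqueness of signs.
point-with-signs : ∀ {n} (s : Fin n → Sign) → ∃[ z ] z ∈ Cell s →
                   ∃[ x ] (∀ j → sgn (off {n} x j) ≡ s j)
point-with-signs s (z , z∈) = point z z-off , λ j →
  HasSign-unique {x = ℓ (suc (toℕ j)) z} (#⇒HasSign {ℓ (suc (toℕ j)) z} (z-off j)) (z∈ j)
  where
  z-off : z ∈ Complement _
  z-off j = HasSign⇒# {s j} {ℓ (suc (toℕ j)) z} (z∈ j)

-- Dropping the first index lowers the leading nonempty block by one, definitionally by the
-- recursion of `step`.
toList-block-sign : ∀ t r s → toList (tabulate {n = t ℕ.+ (r ℕ.+ s)} (block-sign t r)) ≡
                    List.replicate t Sign.+ List.++ List.replicate r Sign.- List.++ List.replicate s Sign.+
toList-block-sign zero    zero    zero    = refl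
toList-block-sign zero    zero    (suc s) = cong (Sign.+ List.∷_) (toList-block-sign zero zero s)
toList-block-sign zero    (suc r) s       = cong (Sign.- List.∷_) (toList-block-sign zero r s)
toList-block-sign (suc t) r       s       = cong (Sign.+ List.∷_) (toList-block-sign t r s)

block-lengths : ∀ {n t r} → r ℕ.+ t ℕ.≤ n → t ℕ.+ (r ℕ.+ (n ℕ.∸ r ℕ.∸ t)) ≡ n
block-lengths {n} {t} {r} r+t≤n = begin
  t ℕ.+ (r ℕ.+ (n ℕ.∸ r ℕ.∸ t))   ≡⟨ ℕ.+-assoc t r _ ⟨
  t ℕ.+ r ℕ.+ (n ℕ.∸ r ℕ.∸ t)     ≡⟨ cong₂ ℕ._+_ (ℕ.+-comm t r) (ℕ.∸-+-assoc n r t) ⟩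
  r ℕ.+ t ℕ.+ (n ℕ.∸ (r ℕ.+ t))   ≡⟨ ℕ.m+[n∸m]≡n r+t≤n ⟩
  n                               ∎
  where open ≡-Reasoning

-- A second `Shape` of the same word, to be compared with the computed `shape x` by `Shape-unique`.
σ-shape : ∀ {n} (x : Point n) t r → r ℕ.+ t ℕ.≤ n → (r ≡ 0 → t ≡ 0) →
          (∀ j → sgn (off x j) ≡ block-sign t r j) → Shape (σ x)
σ-shape {n} x t r r+t≤n all-plus signs = record
  { t = t ; r = r ; r+t≤n = r+t≤n ; all-plus = all-plus
  ; word = trans (cong toList (tabulate-cong signs))
      (subst (λ m → toList (tabulate {n = m} (block-sign t r)) ≡
          List.replicate t Sign.+ List.++ List.replicate r Sign.- List.++ List.replicate (n ℕ.∸ r ℕ.∸ t) Sign.+)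
        (block-lengths {n} {t} {r} r+t≤n) (toList-block-sign t r (n ℕ.∸ r ℕ.∸ t)))
  }

-- Words

∣-∣-𝚊+𝚋 : ∀ {n} (w : Vec Letter n) → ∣ w ∣[ 𝚊 ] ℕ.+ ∣ w ∣[ 𝚋 ] ≡ n
∣-∣-𝚊+𝚋 []      = refl
∣-∣-𝚊+𝚋 (𝚊 ∷ w) = cong suc (∣-∣-𝚊+𝚋 w)
∣-∣-𝚊+𝚋 (𝚋 ∷ w) = trans (ℕ.+-suc ∣ w ∣[ 𝚊 ] ∣ w ∣[ 𝚋 ]) (cong suc (∣-∣-𝚊+𝚋 w))

binom-𝚋 : ∀ {n} (w : Vec Letter n) → binom w (𝚋 ∷ []) ≡ ∣ w ∣[ 𝚋 ]
binom-𝚋 []      = refl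
binom-𝚋 (𝚊 ∷ w) = binom-𝚋 w
binom-𝚋 (𝚋 ∷ w) = cong suc (binom-𝚋 w)

-- An occurrence is a choice of one `𝚊` and one `𝚋`.
binom-𝚊𝚋≤ : ∀ {n} (w : Vec Letter n) → binom w (𝚊 ∷ 𝚋 ∷ []) ℕ.≤ ∣ w ∣[ 𝚊 ] ℕ.* ∣ w ∣[ 𝚋 ]
binom-𝚊𝚋≤ []      = ℕ.z≤n
binom-𝚊𝚋≤ (𝚊 ∷ w) = ℕ.+-mono-≤ (ℕ.≤-reflexive (binom-𝚋 w)) (binom-𝚊𝚋≤ w)
binom-𝚊𝚋≤ (𝚋 ∷ w) = ℕ.≤-trans (binom-𝚊𝚋≤ w) (ℕ.*-monoʳ-≤ ∣ w ∣[ 𝚊 ] (ℕ.n≤1+n ∣ w ∣[ 𝚋 ]))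

-- With `strip-suc`, this replaces the `with` inside `strip` by equations usable once the number of
-- letters `𝚊` is known.
strip-zero : ∀ {n} (w : Vec Letter n) → ∣ w ∣[ 𝚊 ] ≡ 0 → strip w ≡ 0
strip-zero w eq with ∣ w ∣[ 𝚊 ]
strip-zero w refl | zero = refl

strip-suc : ∀ {n} (w : Vec Letter n) k → ∣ w ∣[ 𝚊 ] ≡ suc k → strip w ≡ binom w (𝚊 ∷ 𝚋 ∷ []) ℕ./ suc k
strip-suc w k eq with ∣ w ∣[ 𝚊 ]
strip-suc w k refl | suc _ = refl

strip≤ : ∀ {n} (w : Vec Letter n) → strip w ℕ.≤ ∣ w ∣[ 𝚋 ]
strip≤ w = go ∣ w ∣[ 𝚊 ] refl
  where
  open ℕ.≤-Reasoning
  go : ∀ k → ∣ w ∣[ 𝚊 ] ≡ k → strip w ℕ.≤ ∣ w ∣[ 𝚋 ]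
  go zero    eq = subst (ℕ._≤ ∣ w ∣[ 𝚋 ]) (sym (strip-zero w eq)) ℕ.z≤n
  go (suc k) eq = begin
    strip w                            ≡⟨ strip-suc w k eq ⟩
    binom w (𝚊 ∷ 𝚋 ∷ []) ℕ./ suc k     ≤⟨ ℕ./-monoˡ-≤ (suc k) (binom-𝚊𝚋≤ w) ⟩
    ∣ w ∣[ 𝚊 ] ℕ.* ∣ w ∣[ 𝚋 ] ℕ./ suc k ≡⟨ cong (ℕ._/ suc k) (trans (cong (ℕ._* ∣ w ∣[ 𝚋 ]) eq) (ℕ.*-comm (suc k) _)) ⟩
    ∣ w ∣[ 𝚋 ] ℕ.* suc k ℕ./ suc k      ≡⟨ ℕ.m*n/n≡m ∣ w ∣[ 𝚋 ] (suc k) ⟩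
    ∣ w ∣[ 𝚋 ]                          ∎

𝚋𝚊𝚋 : ∀ p r t → Vec Letter (p ℕ.+ (r ℕ.+ t))
𝚋𝚊𝚋 p r t = replicate p 𝚋 ++ replicate r 𝚊 ++ replicate t 𝚋

∣𝚋𝚊𝚋∣ : ∀ p r t → ∣ 𝚋𝚊𝚋 p r t ∣[ 𝚊 ] ≡ r
∣𝚋𝚊𝚋∣ (suc p) r       t       = ∣𝚋𝚊𝚋∣ p r t
∣𝚋𝚊𝚋∣ zero    (suc r) t       = cong suc (∣𝚋𝚊𝚋∣ zero r t)
∣𝚋𝚊𝚋∣ zero    zero    (suc t) = ∣𝚋𝚊𝚋∣ zero zero t
∣𝚋𝚊𝚋∣ zero    zero    zero    = refl

binom-𝚊𝚋-𝚋 : ∀ r t → binom (𝚋𝚊𝚋 0 r t) (𝚋 ∷ []) ≡ t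
binom-𝚊𝚋-𝚋 (suc r) t       = binom-𝚊𝚋-𝚋 r t
binom-𝚊𝚋-𝚋 zero    (suc t) = cong suc (binom-𝚊𝚋-𝚋 zero t)
binom-𝚊𝚋-𝚋 zero    zero    = refl

-- The leading letters `𝚋` start no occurrence, and each `𝚊` starts exactly `t`.
binom-𝚋𝚊𝚋 : ∀ p r t → binom (𝚋𝚊𝚋 p r t) (𝚊 ∷ 𝚋 ∷ []) ≡ r ℕ.* t
binom-𝚋𝚊𝚋 (suc p) r       t       = binom-𝚋𝚊𝚋 p r t
binom-𝚋𝚊𝚋 zero    (suc r) t       = cong₂ ℕ._+_ (binom-𝚊𝚋-𝚋 r t) (binom-𝚋𝚊𝚋 zero r t)
binom-𝚋𝚊𝚋 zero    zero    (suc t) = binom-𝚋𝚊𝚋 zero zero t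
binom-𝚋𝚊𝚋 zero    zero    zero    = refl

-- For `r = 0` the value is 0 by convention, which is where the hypothesis enters.
strip-𝚋𝚊𝚋 : ∀ p r t → (r ≡ 0 → t ≡ 0) → strip (𝚋𝚊𝚋 p r t) ≡ t
strip-𝚋𝚊𝚋 p zero    t t≡0 = trans (strip-zero (𝚋𝚊𝚋 p 0 t) (∣𝚋𝚊𝚋∣ p 0 t)) (sym (t≡0 refl))
strip-𝚋𝚊𝚋 p (suc r) t _   = begin
  strip (𝚋𝚊𝚋 p (suc r) t)                            ≡⟨ strip-suc (𝚋𝚊𝚋 p (suc r) t) r (∣𝚋𝚊𝚋∣ p (suc r) t) ⟩
  binom (𝚋𝚊𝚋 p (suc r) t) (𝚊 ∷ 𝚋 ∷ []) ℕ./ suc r     ≡⟨ cong (ℕ._/ suc r) (binom-𝚋𝚊𝚋 p (suc r) t) ⟩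
  suc r ℕ.* t ℕ./ suc r                              ≡⟨ cong (ℕ._/ suc r) (ℕ.*-comm (suc r) t) ⟩
  t ℕ.* suc r ℕ./ suc r                              ≡⟨ ℕ.m*n/n≡m t (suc r) ⟩
  t                                                  ∎
  where open ≡-Reasoning

-- Bijectivity of `Ψ`

cast-invariant : ∀ (f : ∀ {k} → Vec Letter k → ℕ) {m n} (m≡n : m ≡ n) (w : Vec Letter m) →
                 f (cast m≡n w) ≡ f w
cast-invariant f refl w = cong f (cast-is-id refl w)

Ψ-length : ∀ {n} (x : Point n) → n ℕ.∸ r x ℕ.∸ t x ℕ.+ (r x ℕ.+ t x) ≡ n
Ψ-length {n} x = trans (cong (ℕ._+ (r x ℕ.+ t x)) (ℕ.∸-+-assoc n (r x) (t x)))
                       (ℕ.m∸n+n≡m (Shape.r+t≤n (shape x)))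

∣Ψ∣ : ∀ {n} (x : Point n) → ∣ Ψ n x ∣[ 𝚊 ] ≡ r x
∣Ψ∣ {n} x = trans (cast-invariant ∣_∣[ 𝚊 ] (Ψ-length x) (𝚋𝚊𝚋 (n ℕ.∸ r x ℕ.∸ t x) (r x) (t x)))
                  (∣𝚋𝚊𝚋∣ (n ℕ.∸ r x ℕ.∸ t x) (r x) (t x))

strip-Ψ : ∀ {n} (x : Point n) → strip (Ψ n x) ≡ t x
strip-Ψ {n} x = trans (cast-invariant strip (Ψ-length x) (𝚋𝚊𝚋 (n ℕ.∸ r x ℕ.∸ t x) (r x) (t x)))
                      (strip-𝚋𝚊𝚋 (n ℕ.∸ r x ℕ.∸ t x) (r x) (t x) (Shape.all-plus (shape x)))

Ψ-cong : ∀ {n} {x y : Point n} → SameComponent x y → Ψ n x ∼ Ψ n y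
Ψ-cong {n} {x} {y} same =
  let (t≡ , r≡) = blocks≡ (tabulate-cong (connected⇒sgn≡ {n} {x} {y} same)) (shape x) (shape y) in
  trans (∣Ψ∣ x) (trans r≡ (sym (∣Ψ∣ y))) , trans (strip-Ψ x) (trans t≡ (sym (strip-Ψ y)))
  where
  -- Generalised to arbitrary words so that their equality can be matched with `refl`.
  blocks≡ : ∀ {v w : Vec Sign n} → v ≡ w → (p : Shape v) (q : Shape w) →
            Shape.t p ≡ Shape.t q × Shape.r p ≡ Shape.r q
  blocks≡ refl = Shape-unique

-- The two class invariants recover `r` and `t`, these determine the sign word, and equal sign words
-- place both points in one convex cell.
Ψ-injective : ∀ {n} {x y : Point n} → Ψ n x ∼ Ψ n y → SameComponent x y
Ψ-injective {n} {x} {y} (∣Ψx∣≡∣Ψy∣ , strip≡) = sgn≡⇒connected {n} {x} {y} λ j → begin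
  sgn (off x j)      ≡⟨ lookup∘tabulate (λ j → sgn (off x j)) j ⟨
  lookup (σ x) j     ≡⟨ cong (λ w → lookup w j) σx≡σy ⟩
  lookup (σ y) j     ≡⟨ lookup∘tabulate (λ j → sgn (off y j)) j ⟩
  sgn (off y j)      ∎
  where
  open ≡-Reasoning
  r≡ : r x ≡ r y
  r≡ = trans (sym (∣Ψ∣ x)) (trans ∣Ψx∣≡∣Ψy∣ (∣Ψ∣ y))
  t≡ : t x ≡ t y
  t≡ = trans (sym (strip-Ψ x)) (trans strip≡ (strip-Ψ y))
  word≡ : toList (σ x) ≡ toList (σ y)
  word≡ = begin
    toList (σ x)  ≡⟨ Shape.word (shape x) ⟩
    _             ≡⟨ cong₂ (λ t r → List.replicate t Sign.+ List.++ List.replicate r Sign.-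
                       List.++ List.replicate (n ℕ.∸ r ℕ.∸ t) Sign.+) t≡ r≡ ⟩
    _             ≡⟨ Shape.word (shape y) ⟨
    toList (σ y)  ∎
  σx≡σy : σ x ≡ σ y
  σx≡σy = trans (sym (cast-is-id refl (σ x))) (toList-injective refl (σ x) (σ y) word≡)

Ψ-hits : ∀ {n} (w : Vec Letter n) → ∃[ x ] Ψ n x ∼ w
Ψ-hits {n} w = hits (point-with-signs (block-sign (strip w) ∣ w ∣[ 𝚊 ])
                      (block-cell-nonempty (strip w) ∣ w ∣[ 𝚊 ]))
  where
  fits : ∣ w ∣[ 𝚊 ] ℕ.+ strip w ℕ.≤ n
  -- The bound `strip≤` leaves enough letters `𝚋` for the block of length `strip w`.
  fits = subst (∣ w ∣[ 𝚊 ] ℕ.+ strip w ℕ.≤_) (∣-∣-𝚊+𝚋 w) (ℕ.+-monoʳ-≤ ∣ w ∣[ 𝚊 ] (strip≤ w))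
  hits : ∃[ x ] (∀ j → sgn (off {n} x j) ≡ block-sign (strip w) ∣ w ∣[ 𝚊 ] j) → ∃[ x ] Ψ n x ∼ w
  hits (x , signs) =
    let (t≡ , r≡) = Shape-unique (shape x)
                      (σ-shape x (strip w) ∣ w ∣[ 𝚊 ] fits (strip-zero w) signs) in
    x , trans (∣Ψ∣ x) r≡ , trans (strip-Ψ x) t≡

proposition9 : (n : ℕ) → .{{_ : NonZero n}} →
    IsBijection (Setoid._≈_ (Ch n)) (Setoid._≈_ (Words/∼ n)) (Ψ n)
proposition9 n = record
  { isInjection = record
    { isCongruent = record
      { cong           = λ {x} {y} → Ψ-cong {n} {x} {y}
      ; isEquivalence₁ = Setoid.isEquivalence (Ch n)
      ; isEquivalence₂ = Setoid.isEquivalence (Words/∼ n)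
      }
    ; injective = λ {x} {y} → Ψ-injective {n} {x} {y}
    }
  -- Surjectivity between setoids asks that every point of the chamber of `x` be sent to the class
  -- of `w`, hence the appeal to `Ψ-cong`.
  ; surjective = λ w → let (x , Ψx∼w) = Ψ-hits w in
      x , λ {z} z≈x → Setoid.trans (Words/∼ n) {Ψ n z} {Ψ n x} {w} (Ψ-cong {n} {z} {x} z≈x) Ψx∼w
  }
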